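{- Let $a,b\in\mathbb{Z}\setminus\{0\}$ and $a_1,a_2,b_1,b_2,c\in\mathbb{Z}$. Then the affine cubic surface $$\bigl(xyz=ax^3+by^3+c+a_2x^2+a_1x+b_2y^2+b_1y\bigr)\subset\mathbb{A}^3$$ has infinitely many integral points, i.e. the equation $xyz=ax^3+by^3+c+a_2x^2+a_1x+b_2y^2+b_1y$ has infinitely many solutions $(x,y,z)\in\mathbb{Z}^3$. -}

module Defs where

open import Data.Integer using (ℤ; _+_; _*_; _^_)
open import Data.Product using (_×_; _,_; ∃)
open import Data.List using (List)
open import Data.List.Membership.Propositional using (_∉_)
open import Relation.Binary.PropositionalEquality using (_≡_)

IsSolution : (a b a₁ a₂ b₁ b₂ c : ℤ) → ℤ × ℤ × ℤ → Set
IsSolution a b a₁ a₂ b₁ b₂ c (x , y , z) =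
  x * y * z ≡ a * x ^ 3 + b * y ^ 3 + c + a₂ * x ^ 2 + a₁ * x + b₂ * y ^ 2 + b₁ * y

InfinitelyMany : {A : Set} → (A → Set) → Set
InfinitelyMany {A} P = (L : List A) → ∃ λ p → P p × p ∉ L

{-# OPTIONS --safe #-}
module Submission where

-- Put P₁ (x) = a x³ + a₂ x² + a₁ x + c. A solution arises from a sequence of integers with
-- w₍ₙ₊₁₎ w₍ₙ₋₁₎ = Qₙ (wₙ), where Q₀ = P₁ and x = w₀, y = w₋₁: the cubics Qₙ are determined by the requirement
-- that integrality propagates (Q₍ₙ₊₁₎ is essentially t³ Q₍ₙ₋₁₎ (Qₙ (0) / t)), as long as consecutive terms are coprime.
-- If |abc| ≥ 2, the constant terms of Qₙ grow without bound; starting with w₍ₙ₊₂₎ = w₍ₙ₊₁₎ = 1 for larger and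
-- larger n and running down to w₀ gives larger and larger solutions.
-- If |abc| = 1, sign changes reduce to a = b = c = 1, where the sequence of cubics has period 4, so that one pair
-- of sufficiently large consecutive terms yields infinitely many solutions. Such a pair is found starting
-- from ±1 if some |F (±1)| ≥ 3 for a cubic F of the sequence; only finitely many cubics remain otherwise.
-- If c = 0, or if a = b = c = 1 and some F (±1) = 0, the surface contains a curve with an integral polynomial parametrisation.

open import Defs
open import Data.Empty using (⊥-elim)
open import Data.Integer using (ℤ; 0ℤ; 1ℤ; -1ℤ; +_; -[1+_]; -_; _+_; _*_; _-_; _^_) renaming (∣_∣ to abs)
open import Data.Integer.Divisibility.Signed using (_∣_; divides; _∣?_; ∣-refl; ∣m⇒∣m*n; ∣n⇒∣m*n)
open import Data.Integer.Properties using (*-comm; *-identityˡ; *-identityʳ; abs-*; ∣-i∣≡∣i∣; ∣i+j∣≤∣i∣+∣j∣)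
open import Data.Integer.Tactic.RingSolver using (solve-∀)
open import Data.List using (List; []; _∷_; map; filter; cartesianProduct)
open import Data.List.Membership.Propositional using (_∈_)
open import Data.List.Membership.Propositional.Properties using (∈-filter⁺; ∈-cartesianProduct⁺)
open import Data.List.Relation.Unary.All using (All; all?; lookup)
open import Data.List.Relation.Unary.Any using (Any; any?; here; there)
open import Data.Nat using (ℕ; zero; suc; z≤n; s≤s; NonZero; >-nonZero; _⊔_; _≤?_) renaming (_+_ to _⊹_; _*_ to _·_; _≤_ to _≤ₙ_)
open import Data.Nat.ListAction using (sum)
import Data.Nat.Properties as ℕₚ
import Data.Nat.Tactic.RingSolver as ℕ-Solver
open import Data.Product using (∃; ∃₂; _×_; _,_; proj₁; proj₂)
open import Data.Sum using (_⊎_; inj₁; inj₂)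
open import Data.Unit using (tt)
open import Relation.Binary.PropositionalEquality using (_≡_; _≢_; refl; sym; trans; cong; cong₂; subst; subst₂; module ≡-Reasoning)
open import Relation.Nullary using (Dec; yes; no)
open import Relation.Nullary.Decidable using (toWitness; _×-dec_)

record Cubic : Set where
  constructor ⟨_,_,_,_⟩
  field
    lead quad lin const : ℤ
open Cubic

⟦_⟧ : Cubic → ℤ → ℤ
⟦ ⟨ l , p , q , k ⟩ ⟧ t = l * (t * t * t) + p * (t * t) + q * t + k

-- t ³ Q (k′ / t), divided by the constant term of Q when k′ = r · const Q.
reflect : ℤ → ℤ → Cubic → Cubic
reflect r k′ ⟨ l , p , q , k ⟩ = ⟨ 1ℤ , q * r , p * r * k′ , l * k′ * r * k′ ⟩

-- Coprimality, carried by explicit Bézout identities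

Bezout : ℤ → ℤ → Set
Bezout m n = ∃₂ λ s t → s * m + t * n ≡ 1ℤ

bezout-∣ : ∀ {v m n} → m ∣ n → Bezout v n → Bezout v m
bezout-∣ {v} {m} (divides d refl) (s , t , eq) = s , t * d , trans (identity s t v m d) eq
  where
  identity : ∀ s t v m d → s * v + t * d * m ≡ s * v + t * (d * m)
  identity = solve-∀

bezout-* : ∀ {v m n} → Bezout v m → Bezout v n → Bezout v (m * n)
bezout-* {v} {m} {n} (s , t , eq) (s′ , t′ , eq′) =
  s * (s′ * v + t′ * n) + t * m * s′ , t * t′ , (begin
    (s * (s′ * v + t′ * n) + t * m * s′) * v + t * t′ * (m * n)  ≡⟨ identity s t s′ t′ v m n ⟩
    (s * v + t * m) * (s′ * v + t′ * n)                          ≡⟨ cong₂ _*_ eq eq′ ⟩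
    1ℤ                                                           ∎)
  where
  open ≡-Reasoning
  identity : ∀ s t s′ t′ v m n →
    (s * (s′ * v + t′ * n) + t * m * s′) * v + t * t′ * (m * n) ≡ (s * v + t * m) * (s′ * v + t′ * n)
  identity = solve-∀

bezout-cancel : ∀ {u v n} → Bezout u v → v ∣ u * n → v ∣ n
bezout-cancel {u} {v} {n} (s , t , eq) (divides d un≡dv) = divides (s * d + t * n) (begin
  n                        ≡⟨ *-identityˡ n ⟨
  1ℤ * n                   ≡⟨ cong (_* n) eq ⟨
  (s * u + t * v) * n      ≡⟨ expand s t u v n ⟩
  s * (u * n) + t * n * v  ≡⟨ cong (λ m → s * m + t * n * v) un≡dv ⟩
  s * (d * v) + t * n * v  ≡⟨ collect s t d n v ⟩
  (s * d + t * n) * v      ∎)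
  where
  open ≡-Reasoning
  expand : ∀ s t u v n → (s * u + t * v) * n ≡ s * (u * n) + t * n * v
  expand = solve-∀
  collect : ∀ s t d n v → s * (d * v) + t * n * v ≡ (s * d + t * n) * v
  collect = solve-∀

-- Q (v) is congruent to `const Q` modulo `v`, so each of its factors is coprime to `v`.
bezout-value : ∀ Q {v u w} → Bezout v (const Q) → u * w ≡ ⟦ Q ⟧ v → Bezout w v
bezout-value ⟨ l , p , q , k ⟩ {v} {u} {w} (s , t , eq) uw≡Qv =
  t * u , s - t * (l * (v * v) + p * v + q) , (begin
    t * u * w + (s - t * (l * (v * v) + p * v + q)) * v                           ≡⟨ expand l p q v s t u w ⟩
    t * (u * w) + (s - t * (l * (v * v) + p * v + q)) * v                         ≡⟨ cong (λ m → t * m + _) uw≡Qv ⟩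
    t * ⟦ ⟨ l , p , q , k ⟩ ⟧ v + (s - t * (l * (v * v) + p * v + q)) * v         ≡⟨ collect l p q k v s t ⟩
    s * v + t * k                                                                 ≡⟨ eq ⟩
    1ℤ                                                                            ∎)
  where
  open ≡-Reasoning
  expand : ∀ l p q v s t u w → t * u * w + (s - t * (l * (v * v) + p * v + q)) * v
    ≡ t * (u * w) + (s - t * (l * (v * v) + p * v + q)) * v
  expand = solve-∀
  collect : ∀ l p q k v s t →
    t * (l * (v * v * v) + p * (v * v) + q * v + k) + (s - t * (l * (v * v) + p * v + q)) * v ≡ s * v + t * k
  collect = solve-∀

bezout-sym : ∀ {m n} → Bezout m n → Bezout n m
bezout-sym {m} {n} (s , t , eq) = t , s , trans (identity s t m n) eq
  where
  identity : ∀ s t m n → t * n + s * m ≡ s * m + t * n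
  identity = solve-∀

record CubeMod (N : ℤ) (Q : Cubic) : Set where
  constructor cubeMod
  field
    monic  : lead Q ≡ 1ℤ
    ∣quad  : N ∣ quad Q
    ∣lin   : N ∣ lin Q
    ∣const : N ∣ const Q

-- Modulo `N` the cubic is t ³, so u w ≡ v ³, and a Bézout identity for `N` and v ³ turns into one
-- for `w` and `N`.
bezout-next : ∀ {N Q v u w} → CubeMod N Q → Bezout v N → u * w ≡ ⟦ Q ⟧ v → Bezout w N
bezout-next {N} {Q} {v} {u} {w} (cubeMod refl (divides p refl) (divides q refl) (divides k refl)) coprime uw≡Qv
  with bezout-* coprime′ (bezout-* coprime′ coprime′) where coprime′ = bezout-sym coprime
... | s , t , eq = t * u , s - t * e , (begin
    t * u * w + (s - t * e) * N             ≡⟨ expand t u w s e N ⟩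
    t * (u * w) + (s - t * e) * N           ≡⟨ cong (λ m → t * m + (s - t * e) * N) uw≡Qv ⟩
    t * ⟦ Q ⟧ v + (s - t * e) * N           ≡⟨ collect p q k v s t N ⟩
    s * N + t * (v * (v * v))               ≡⟨ eq ⟩
    1ℤ                                      ∎)
  where
  open ≡-Reasoning
  e = p * (v * v) + q * v + k
  expand : ∀ t u w s e N → t * u * w + (s - t * e) * N ≡ t * (u * w) + (s - t * e) * N
  expand = solve-∀
  collect : ∀ p q k v s t N →
    t * (1ℤ * (v * v * v) + p * N * (v * v) + q * N * v + k * N) + (s - t * (p * (v * v) + q * v + k)) * N
    ≡ s * N + t * (v * (v * v))
  collect = solve-∀

-- Linked pairs and the step down the sequence

Linked : Cubic → Cubic → ℤ → ℤ → Set
Linked Q Q′ u v = u ∣ ⟦ Q ⟧ v × v ∣ ⟦ Q′ ⟧ u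

-- Modulo v we have u w ≡ const Q′ = r · const Q, so u ³ Q (w) is const Q times the value at u
-- of the reflection of Q.
reflect-∣ : ∀ Q Q′ {r u v w} → const Q′ ≡ r * const Q → u * w ≡ ⟦ Q′ ⟧ v →
  v ∣ ⟦ reflect r (const Q′) Q ⟧ u → v ∣ u * (u * (u * ⟦ Q ⟧ w))
reflect-∣ ⟨ l , p , q , k ⟩ ⟨ l′ , p′ , q′ , k′ ⟩ {r} {u} {v} {w} refl uw≡ (divides d eq) =
  divides (k * d + E h) (begin
    u * (u * (u * (l * (w * w * w) + p * (w * w) + q * w + k)))  ≡⟨ clear l p q k u w ⟩
    V (u * w)                                                    ≡⟨ cong V (trans uw≡ (split l′ p′ q′ (r * k) v)) ⟩
    V (h * v + r * k)                                            ≡⟨ reduce l p q k r u v h ⟩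
    k * (⟦ reflect r (r * k) ⟨ l , p , q , k ⟩ ⟧ u) + E h * v    ≡⟨ cong (λ m → k * m + E h * v) eq ⟩
    k * (d * v) + E h * v                                        ≡⟨ collect k d v (E h) ⟩
    (k * d + E h) * v                                            ∎)
  where
  open ≡-Reasoning
  h = l′ * (v * v) + p′ * v + q′
  -- `V X` is u ³ Q (X / u), and `E h` is the quotient of V (h v + r k) - V (r k) by `v`.
  V E : ℤ → ℤ
  V X = l * (X * X * X) + p * u * (X * X) + q * (u * u) * X + k * (u * u * u)
  E h = l * (h * h * h * v * v + (h * h * v + h * h * v + h * h * v) * (r * k) + (h + h + h) * (r * k) * (r * k))
    + p * u * (h * h * v + (h + h) * (r * k)) + q * (u * u) * h
  clear : ∀ l p q k u w → u * (u * (u * (l * (w * w * w) + p * (w * w) + q * w + k)))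
    ≡ l * (u * w * (u * w) * (u * w)) + p * u * (u * w * (u * w)) + q * (u * u) * (u * w) + k * (u * u * u)
  clear = solve-∀
  split : ∀ l p q k v → l * (v * v * v) + p * (v * v) + q * v + k ≡ (l * (v * v) + p * v + q) * v + k
  split = solve-∀
  reduce : ∀ l p q k r u v h →
    l * ((h * v + r * k) * (h * v + r * k) * (h * v + r * k)) + p * u * ((h * v + r * k) * (h * v + r * k))
      + q * (u * u) * (h * v + r * k) + k * (u * u * u)
    ≡ k * (1ℤ * (u * u * u) + q * r * (u * u) + p * r * (r * k) * u + l * (r * k) * r * (r * k))
      + (l * (h * h * h * v * v + (h * h * v + h * h * v + h * h * v) * (r * k) + (h + h + h) * (r * k) * (r * k))
        + p * u * (h * h * v + (h + h) * (r * k)) + q * (u * u) * h) * v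
  reduce = solve-∀
  collect : ∀ k d v e → k * (d * v) + e * v ≡ (k * d + e) * v
  collect = solve-∀

-- Here `u`, `v`, `w` are w₍ₙ₊₁₎, wₙ, w₍ₙ₋₁₎, and `Q′` is Qₙ. As a factor of Q′ (v), `u` is coprime
-- to `v`, so the three factors `u` left by `reflect-∣` cancel one after another.
linked-next : ∀ Q Q′ {r u v w} → const Q′ ≡ r * const Q → Linked Q′ (reflect r (const Q′) Q) u v →
  Bezout v (const Q′) → u * w ≡ ⟦ Q′ ⟧ v → Linked Q Q′ v w
linked-next Q Q′ {r} {u} {v} {w} k≡ (_ , v∣) coprime uw≡ =
  bezout-cancel {u} {v} {⟦ Q ⟧ w} uv (bezout-cancel {u} {v} {u * ⟦ Q ⟧ w} uv
    (bezout-cancel {u} {v} {u * (u * ⟦ Q ⟧ w)} uv (reflect-∣ Q Q′ {r} {u} {v} {w} k≡ uw≡ v∣))) , divides u (sym uw≡)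
  where
  uv : Bezout u v
  uv = bezout-value Q′ {v} {w} {u} coprime (trans (*-comm w u) uw≡)

-- Growth of the terms

record Bounded (M : ℕ) (Q : Cubic) : Set where
  constructor bounded
  field
    monic  : lead Q ≡ 1ℤ
    quad≤  : abs (quad Q) ≤ₙ M
    lin≤   : abs (lin Q) ≤ₙ M
    const≤ : abs (const Q) ≤ₙ M

abs-+₄ : ∀ i j k l → abs (i + j + k + l) ≤ₙ abs i ⊹ abs j ⊹ abs k ⊹ abs l
abs-+₄ i j k l = ℕₚ.≤-trans (∣i+j∣≤∣i∣+∣j∣ (i + j + k) l) (ℕₚ.+-monoˡ-≤ (abs l)
  (ℕₚ.≤-trans (∣i+j∣≤∣i∣+∣j∣ (i + j) k) (ℕₚ.+-monoˡ-≤ (abs k) (∣i+j∣≤∣i∣+∣j∣ i j))))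

-- The leading term has absolute value at least (2 M + 2) V ² with V = ∣ v ∣. The quadratic term
-- takes away at most M V ², and so do the linear and constant terms together, because V + 1 ≤ V ².
cubic-lower : ∀ {M} Q v → Bounded M Q → 2 · M ⊹ 2 ≤ₙ abs v → 2 · (abs v · abs v) ≤ₙ abs (⟦ Q ⟧ v)
cubic-lower {M} Q@(⟨ l , p , q , k ⟩) v (bounded refl p≤ q≤ k≤) big =
  ℕₚ.+-cancelʳ-≤ (M · (V · V) ⊹ M · (V · V)) _ _ (begin
    2 · (V · V) ⊹ (M · (V · V) ⊹ M · (V · V))          ≡⟨ collect M V ⟩
    (2 · M ⊹ 2) · (V · V)                              ≤⟨ ℕₚ.*-monoˡ-≤ (V · V) big ⟩
    V · (V · V)                                        ≡⟨ abs-cube ⟩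
    abs (v * v * v)                                    ≡⟨ cong abs (isolate p q k v) ⟩
    abs (⟦ Q ⟧ v + - p * (v * v) + - q * v + - k)      ≤⟨ abs-+₄ (⟦ Q ⟧ v) (- p * (v * v)) (- q * v) (- k) ⟩
    abs (⟦ Q ⟧ v) ⊹ abs (- p * (v * v)) ⊹ abs (- q * v) ⊹ abs (- k)
      ≤⟨ ℕₚ.+-mono-≤ (ℕₚ.+-mono-≤ (ℕₚ.+-monoʳ-≤ (abs (⟦ Q ⟧ v)) quad≤) lin≤) const≤ ⟩
    abs (⟦ Q ⟧ v) ⊹ M · (V · V) ⊹ M · V ⊹ M            ≡⟨ regroup (abs (⟦ Q ⟧ v)) M V ⟩
    abs (⟦ Q ⟧ v) ⊹ (M · (V · V) ⊹ M · (V ⊹ 1))        ≤⟨ ℕₚ.+-monoʳ-≤ (abs (⟦ Q ⟧ v)) (ℕₚ.+-monoʳ-≤ (M · (V · V)) (ℕₚ.*-monoʳ-≤ M V+1≤V²)) ⟩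
    abs (⟦ Q ⟧ v) ⊹ (M · (V · V) ⊹ M · (V · V))        ∎)
  where
  open ℕₚ.≤-Reasoning
  V = abs v
  2≤V : 2 ≤ₙ V
  2≤V = ℕₚ.≤-trans (ℕₚ.m≤n+m 2 (2 · M)) big
  V+1≤V² : V ⊹ 1 ≤ₙ V · V
  V+1≤V² = begin
    V ⊹ 1  ≤⟨ ℕₚ.+-monoʳ-≤ V (ℕₚ.≤-trans (s≤s z≤n) 2≤V) ⟩
    V ⊹ V  ≡⟨ double V ⟩
    2 · V  ≤⟨ ℕₚ.*-monoˡ-≤ V 2≤V ⟩
    V · V  ∎
    where
    double : ∀ V → V ⊹ V ≡ 2 · V
    double = ℕ-Solver.solve-∀
  abs-cube : V · (V · V) ≡ abs (v * v * v)
  abs-cube = sym (trans (abs-* (v * v) v) (trans (cong (_· V) (abs-* v v)) (ℕₚ.*-comm (V · V) V)))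
  quad≤ : abs (- p * (v * v)) ≤ₙ M · (V · V)
  quad≤ rewrite abs-* (- p) (v * v) | abs-* v v | ∣-i∣≡∣i∣ p = ℕₚ.*-monoˡ-≤ (V · V) p≤
  lin≤ : abs (- q * v) ≤ₙ M · V
  lin≤ rewrite abs-* (- q) v | ∣-i∣≡∣i∣ q = ℕₚ.*-monoˡ-≤ V q≤
  const≤ : abs (- k) ≤ₙ M
  const≤ rewrite ∣-i∣≡∣i∣ k = k≤
  collect : ∀ M V → 2 · (V · V) ⊹ (M · (V · V) ⊹ M · (V · V)) ≡ (2 · M ⊹ 2) · (V · V)
  collect = ℕ-Solver.solve-∀
  regroup : ∀ X M V → X ⊹ M · (V · V) ⊹ M · V ⊹ M ≡ X ⊹ (M · (V · V) ⊹ M · (V ⊹ 1))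
  regroup = ℕ-Solver.solve-∀
  isolate : ∀ p q k v →
    v * v * v ≡ (1ℤ * (v * v * v) + p * (v * v) + q * v + k) + - p * (v * v) + - q * v + - k
  isolate = solve-∀

-- Dividing the lower bound 2 v ² by ∣ u ∣ ≤ ∣ v ∣ leaves 2 ∣ v ∣. The hypotheses thus reproduce
-- themselves as long as the next cubics stay bounded accordingly.
growth : ∀ {M} Q {u v w} → Bounded M Q → 2 · M ⊹ 2 ≤ₙ abs v → abs u ≤ₙ abs v → u * w ≡ ⟦ Q ⟧ v →
  2 · abs v ≤ₙ abs w
growth {M} Q {u} {v} {w} bd big u≤v uw≡ = ℕₚ.*-cancelˡ-≤ (abs v) (begin
  abs v · (2 · abs v)  ≡⟨ swap (abs v) ⟩
  2 · (abs v · abs v)  ≤⟨ cubic-lower Q v bd big ⟩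
  abs (⟦ Q ⟧ v)        ≡⟨ cong abs uw≡ ⟨
  abs (u * w)          ≡⟨ abs-* u w ⟩
  abs u · abs w        ≤⟨ ℕₚ.*-monoˡ-≤ (abs w) u≤v ⟩
  abs v · abs w        ∎)
  where
  open ℕₚ.≤-Reasoning
  instance
    v≢0 : NonZero (abs v)
    v≢0 = >-nonZero (ℕₚ.≤-trans (ℕₚ.≤-trans (s≤s z≤n) (ℕₚ.m≤n+m 2 (2 · M))) big)
  swap : ∀ V → V · (2 · V) ≡ 2 · (V · V)
  swap = ℕ-Solver.solve-∀

-- The state of the descent: `u` = w₍ₙ₊₁₎ and `v` = wₙ for `Q` = Qₙ and `Q′` = Q₍ₙ₊₁₎. The primes of
-- `N` are those that `v` avoids.
record Point (Q Q′ : Cubic) (N : ℤ) (bound : ℕ) : Set where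
  constructor point
  field
    u v     : ℤ
    linked  : Linked Q Q′ u v
    coprime : Bezout v N
    u≤v     : abs u ≤ₙ abs v
    bound≤v : bound ≤ₙ abs v

-- There are two moduli because `Q′` may be t ³ only modulo an `N′` with fewer primes than `N`.
-- Coprimality to `N` serves the present step, coprimality to `N′` is passed on.
point-next : ∀ {N N′ M b} Q Q′ {r} → const Q′ ≡ r * const Q →
  (∀ {v} → Bezout v N → Bezout v (const Q′)) → (∀ {v} → Bezout v N → Bezout v N′) →
  CubeMod N′ Q′ → Bounded M Q′ → 2 · M ⊹ 2 ≤ₙ b →
  Point Q′ (reflect r (const Q′) Q) N b → Point Q Q′ N′ (2 · b)
point-next {N} {N′} {M} {b} Q Q′ {r} k≡ smooth restrict cube bd big
  (point u v l@(divides w eq , _) coprime u≤v b≤v) =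
  point v w (linked-next Q Q′ {r} {u} {v} {w} k≡ l (smooth coprime) uw≡)
    (bezout-next {N′} {Q′} {v} {u} {w} cube (restrict coprime) uw≡)
    (ℕₚ.≤-trans (ℕₚ.m≤m+n (abs v) _) grown) (ℕₚ.≤-trans (ℕₚ.*-monoʳ-≤ 2 b≤v) grown)
  where
  uw≡ : u * w ≡ ⟦ Q′ ⟧ v
  uw≡ = trans (*-comm u w) (sym eq)
  grown : 2 · abs v ≤ₙ abs w
  grown = growth Q′ {u} {v} {w} bd (ℕₚ.≤-trans big b≤v) u≤v uw≡

size : ℤ × ℤ × ℤ → ℕ
size (x , y , z) = abs x ⊹ abs y ⊹ abs z

Unbounded : (ℤ × ℤ × ℤ → Set) → Set
Unbounded P = ∀ B → ∃ λ s → P s × B ≤ₙ size s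

-- From the first cubics to the surface

module Start (a b a₁ a₂ b₁ b₂ c : ℤ) where
  P₁ Q₁ Q₂ : Cubic
  P₁ = ⟨ a , a₂ , a₁ , c ⟩
  -- The cubic in y has the same constant term `c` as `P₁`, hence the ratio 1. The next ratio
  -- `b * c * 1ℤ` is that of `const Q₁` to `c`.
  Q₁ = reflect 1ℤ c ⟨ b , b₂ , b₁ , c ⟩
  Q₂ = reflect (b * c * 1ℤ) (const Q₁) P₁

  -- With P₁ (x) = y v the equation reads x z = v + b₁ + b₂ y + b y ², and modulo x
  -- the right-hand side times v ² is Q₁ (v).
  x∣S : ∀ u v x y → ⟦ P₁ ⟧ x ≡ y * v → ⟦ Q₁ ⟧ v ≡ u * x → Bezout v (const Q₁) →
    x ∣ v + b₁ + b₂ * y + b * (y * y)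
  x∣S u v x y P₁x≡yv Q₁v≡ux coprime =
    bezout-cancel {v} {x} {S} vx (bezout-cancel {v} {x} {v * S} vx (divides (u + E) v²S≡))
    where
    open ≡-Reasoning
    vx : Bezout v x
    vx = bezout-sym (bezout-value Q₁ {v} {u} {x} coprime (sym Q₁v≡ux))
    f S E : ℤ
    f = a * (x * x) + a₂ * x + a₁
    S = v + b₁ + b₂ * y + b * (y * y)
    E = b₂ * v * f + b * (c * f + c * f + f * f * x)
    clear : ∀ b b₁ b₂ v y → v * (v * (v + b₁ + b₂ * y + b * (y * y)))
      ≡ v * v * v + b₁ * (v * v) + b₂ * v * (y * v) + b * (y * v * (y * v))
    clear = solve-∀
    split : ∀ a a₂ a₁ c x → a * (x * x * x) + a₂ * (x * x) + a₁ * x + c ≡ (a * (x * x) + a₂ * x + a₁) * x + c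
    split = solve-∀
    reduce : ∀ b b₁ b₂ c v f x →
      v * v * v + b₁ * (v * v) + b₂ * v * (f * x + c) + b * ((f * x + c) * (f * x + c))
      ≡ (1ℤ * (v * v * v) + b₁ * 1ℤ * (v * v) + b₂ * 1ℤ * c * v + b * c * 1ℤ * c)
        + (b₂ * v * f + b * (c * f + c * f + f * f * x)) * x
    reduce = solve-∀
    collect : ∀ u x e → u * x + e * x ≡ (u + e) * x
    collect = solve-∀
    v²S≡ : v * (v * S) ≡ (u + E) * x
    v²S≡ = begin
      v * (v * S)                                                              ≡⟨ clear b b₁ b₂ v y ⟩
      v * v * v + b₁ * (v * v) + b₂ * v * (y * v) + b * (y * v * (y * v))
        ≡⟨ cong (λ m → v * v * v + b₁ * (v * v) + b₂ * v * m + b * (m * m)) (trans (sym P₁x≡yv) (split a a₂ a₁ c x)) ⟩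
      v * v * v + b₁ * (v * v) + b₂ * v * (f * x + c) + b * ((f * x + c) * (f * x + c))
        ≡⟨ reduce b b₁ b₂ c v f x ⟩
      ⟦ Q₁ ⟧ v + E * x                                                         ≡⟨ cong (_+ E * x) Q₁v≡ux ⟩
      u * x + E * x                                                            ≡⟨ collect u x E ⟩
      (u + E) * x                                                              ∎

  solution : ∀ v x y z → ⟦ P₁ ⟧ x ≡ y * v → v + b₁ + b₂ * y + b * (y * y) ≡ z * x →
    IsSolution a b a₁ a₂ b₁ b₂ c (x , y , z)
  solution v x y z P₁x≡yv S≡zx = begin
    x * y * z                                                                ≡⟨ move x y z ⟩
    y * (z * x)                                                              ≡⟨ cong (y *_) S≡zx ⟨
    y * (v + b₁ + b₂ * y + b * (y * y))                                      ≡⟨ expand b b₁ b₂ v y ⟩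
    y * v + b₁ * y + b₂ * (y * y) + b * (y * y * y)
      ≡⟨ cong (λ m → m + b₁ * y + b₂ * (y * y) + b * (y * y * y)) P₁x≡yv ⟨
    ⟦ P₁ ⟧ x + b₁ * y + b₂ * (y * y) + b * (y * y * y)                       ≡⟨ reorder a b a₁ a₂ b₁ b₂ c x y ⟩
    a * x ^ 3 + b * y ^ 3 + c + a₂ * x ^ 2 + a₁ * x + b₂ * y ^ 2 + b₁ * y    ∎
    where
    open ≡-Reasoning
    move : ∀ x y z → x * y * z ≡ y * (z * x)
    move = solve-∀
    expand : ∀ b b₁ b₂ v y →
      y * (v + b₁ + b₂ * y + b * (y * y)) ≡ y * v + b₁ * y + b₂ * (y * y) + b * (y * y * y)
    expand = solve-∀
    reorder : ∀ a b a₁ a₂ b₁ b₂ c x y →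
      a * (x * x * x) + a₂ * (x * x) + a₁ * x + c + b₁ * y + b₂ * (y * y) + b * (y * y * y)
      ≡ a * (x * (x * (x * 1ℤ))) + b * (y * (y * (y * 1ℤ))) + c + a₂ * (x * (x * 1ℤ)) + a₁ * x
        + b₂ * (y * (y * 1ℤ)) + b₁ * y
    reorder = solve-∀

  -- With `u` = w₂ and `v` = w₁, one step down gives x = w₀, then y = w₋₁ is P₁ (x) / v, and `x∣S`
  -- supplies z. The size is at least ∣ x ∣ ≥ 2 ∣ v ∣.
  point⇒solution : ∀ {N M B} → (∀ {v} → Bezout v N → Bezout v (const Q₁)) → Bounded M Q₁ → 2 · M ⊹ 2 ≤ₙ B →
    Point Q₁ Q₂ N B → ∃ λ s → IsSolution a b a₁ a₂ b₁ b₂ c s × B ≤ₙ size s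
  point⇒solution {B = B} smooth bd big (point u v l@(divides x eq , _) coprime u≤v B≤v) =
    extend (linked-next P₁ Q₁ {b * c * 1ℤ} {u} {v} {x} refl l (smooth coprime) ux≡)
    where
    open ℕₚ.≤-Reasoning
    ux≡ : u * x ≡ ⟦ Q₁ ⟧ v
    ux≡ = trans (*-comm u x) (sym eq)
    B≤ : ∀ y z → B ≤ₙ size (x , y , z)
    B≤ y z = begin
      B                          ≤⟨ B≤v ⟩
      abs v                      ≤⟨ ℕₚ.m≤m+n (abs v) _ ⟩
      2 · abs v                  ≤⟨ growth Q₁ {u} {v} {x} bd (ℕₚ.≤-trans big B≤v) u≤v ux≡ ⟩
      abs x                      ≤⟨ ℕₚ.m≤m+n (abs x) (abs y) ⟩
      abs x ⊹ abs y              ≤⟨ ℕₚ.m≤m+n (abs x ⊹ abs y) (abs z) ⟩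
      abs x ⊹ abs y ⊹ abs z      ∎
    finish : ∀ y → ⟦ P₁ ⟧ x ≡ y * v → x ∣ v + b₁ + b₂ * y + b * (y * y) →
      ∃ λ s → IsSolution a b a₁ a₂ b₁ b₂ c s × B ≤ₙ size s
    finish y P₁x≡yv (divides z S≡zx) = (x , y , z) , solution v x y z P₁x≡yv S≡zx , B≤ y z
    extend : Linked P₁ Q₁ v x → ∃ λ s → IsSolution a b a₁ a₂ b₁ b₂ c s × B ≤ₙ size s
    extend (divides y P₁x≡yv , divides u′ Q₁v≡) =
      finish y P₁x≡yv (x∣S u′ v x y P₁x≡yv Q₁v≡ (smooth coprime))

-- The case ∣ a b c ∣ ≥ 2

-- An invariant of consecutive cubics. The middle coefficients stay within a fixed multiple of the
-- constant terms. `N` has the same primes as `r`, and they include those of `const Q′`, so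
-- coprimality to one fixed `N` is enough for the whole descent.
record Growing (A : ℕ) (N : ℤ) (Q Q′ : Cubic) (r : ℤ) : Set where
  field
    monic    : lead Q ≡ 1ℤ
    monic′   : lead Q′ ≡ 1ℤ
    const≡   : const Q′ ≡ r * const Q
    1≤const  : 1 ≤ₙ abs (const Q)
    quad≤    : abs (quad Q) ≤ₙ A · abs (const Q)
    lin≤     : abs (lin Q) ≤ₙ A · abs (const Q)
    quad′≤   : abs (quad Q′) ≤ₙ A · abs (const Q′)
    lin′≤    : abs (lin Q′) ≤ₙ A · abs (const Q′)
    2≤r      : 2 ≤ₙ abs r
    N∣r      : N ∣ r
    smooth   : ∀ {v} → Bezout v N → Bezout v (const Q′)
    smooth-r : ∀ {v} → Bezout v N → Bezout v r

module _ {A N Q Q′ r} (g : Growing A N Q Q′ r) where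
  open Growing g
  open ℕₚ.≤-Reasoning

  private
    Q″ = reflect r (const Q′) Q
    -- Bracketed so that `const Q″` is `r′ * const Q′` by definition.
    r′ = lead Q * const Q′ * r
    ρ  = abs r
    k  = abs (const Q)
    k′ = abs (const Q′)

    k′≡ρk : k′ ≡ ρ · k
    k′≡ρk = trans (cong abs const≡) (abs-* r (const Q))

    abs-lead* : ∀ m → abs (lead Q * m) ≡ abs m
    abs-lead* m = trans (abs-* (lead Q) m) (trans (cong (λ l → abs l · abs m) monic) (ℕₚ.*-identityˡ (abs m)))

    abs-r′ : abs r′ ≡ k′ · ρ
    abs-r′ = trans (abs-* (lead Q * const Q′) r) (cong (_· ρ) (abs-lead* (const Q′)))

    2≤k′ : 2 ≤ₙ k′
    2≤k′ = subst (2 ≤ₙ_) (sym k′≡ρk) (ℕₚ.*-mono-≤ 2≤r 1≤const)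

    quad″≤ : abs (quad Q″) ≤ₙ A · k′
    quad″≤ = begin
      abs (lin Q * r)    ≡⟨ abs-* (lin Q) r ⟩
      abs (lin Q) · ρ    ≤⟨ ℕₚ.*-monoˡ-≤ ρ lin≤ ⟩
      A · k · ρ          ≡⟨ rotate A k ρ ⟩
      A · (ρ · k)        ≡⟨ cong (A ·_) k′≡ρk ⟨
      A · k′             ∎
      where
      rotate : ∀ A k ρ → A · k · ρ ≡ A · (ρ · k)
      rotate = ℕ-Solver.solve-∀

    lin″≤ : abs (lin Q″) ≤ₙ A · (k′ · k′)
    lin″≤ = begin
      abs (quad Q * r * const Q′)  ≡⟨ abs-* (quad Q * r) (const Q′) ⟩
      abs (quad Q * r) · k′        ≡⟨ cong (_· k′) (abs-* (quad Q) r) ⟩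
      abs (quad Q) · ρ · k′        ≤⟨ ℕₚ.*-monoˡ-≤ k′ (ℕₚ.*-monoˡ-≤ ρ quad≤) ⟩
      A · k · ρ · k′               ≡⟨ rotate A k ρ k′ ⟩
      A · (ρ · k · k′)             ≡⟨ cong (λ m → A · (m · k′)) k′≡ρk ⟨
      A · (k′ · k′)                ∎
      where
      rotate : ∀ A k ρ k′ → A · k · ρ · k′ ≡ A · (ρ · k · k′)
      rotate = ℕ-Solver.solve-∀

    abs-const″ : abs (const Q″) ≡ ρ · (k′ · k′)
    abs-const″ = trans (abs-* r′ (const Q′)) (trans (cong (_· k′) abs-r′) (rotate k′ ρ))
      where
      rotate : ∀ k′ ρ → k′ · ρ · k′ ≡ ρ · (k′ · k′)
      rotate = ℕ-Solver.solve-∀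

    k′≤k′² : k′ ≤ₙ k′ · k′
    k′≤k′² = begin
      k′       ≡⟨ ℕₚ.*-identityˡ k′ ⟨
      1 · k′   ≤⟨ ℕₚ.*-monoˡ-≤ k′ (ℕₚ.≤-trans (s≤s z≤n) 2≤k′) ⟩
      k′ · k′  ∎

    k′²≤const″ : k′ · k′ ≤ₙ abs (const Q″)
    k′²≤const″ = begin
      k′ · k′          ≡⟨ ℕₚ.*-identityˡ (k′ · k′) ⟨
      1 · (k′ · k′)    ≤⟨ ℕₚ.*-monoˡ-≤ (k′ · k′) (ℕₚ.≤-trans (s≤s z≤n) 2≤r) ⟩
      ρ · (k′ · k′)    ≡⟨ abs-const″ ⟨
      abs (const Q″)   ∎

    k′≤const″ : k′ ≤ₙ abs (const Q″)
    k′≤const″ = ℕₚ.≤-trans k′≤k′² k′²≤const″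

  -- Strict growth lets the ratio reach the size that `point-seed` asks for.
  r<r′ : suc ρ ≤ₙ abs r′
  r<r′ = begin
    1 ⊹ ρ    ≤⟨ ℕₚ.+-monoˡ-≤ ρ (ℕₚ.≤-trans (s≤s z≤n) 2≤r) ⟩
    ρ ⊹ ρ    ≡⟨ double ρ ⟩
    2 · ρ    ≤⟨ ℕₚ.*-monoˡ-≤ ρ 2≤k′ ⟩
    k′ · ρ   ≡⟨ abs-r′ ⟨
    abs r′   ∎
    where
    double : ∀ ρ → ρ ⊹ ρ ≡ 2 · ρ
    double = ℕ-Solver.solve-∀

  N∣r′ : N ∣ r′
  N∣r′ = ∣n⇒∣m*n (lead Q * const Q′) N∣r

  smooth-r′ : ∀ {v} → Bezout v N → Bezout v r′
  smooth-r′ {v} cop = bezout-* (bezout-* lead-unit (smooth cop)) (smooth-r cop)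
    where
    lead-unit : Bezout v (lead Q)
    lead-unit rewrite monic = 0ℤ , 1ℤ , unit v
      where
      unit : ∀ v → 0ℤ * v + 1ℤ * 1ℤ ≡ 1ℤ
      unit = solve-∀

  -- Reflection exchanges the middle coefficients and scales them, giving at most A k′ and A k′ ²,
  -- whereas the new constant term is ρ k′ ² in absolute value. So the same `A` works again.
  growing-next : Growing A N Q′ Q″ r′
  growing-next = record
    { monic    = monic′
    ; monic′   = refl
    ; const≡   = refl
    ; 1≤const  = ℕₚ.≤-trans (s≤s z≤n) 2≤k′
    ; quad≤    = quad′≤
    ; lin≤     = lin′≤
    ; quad′≤   = ℕₚ.≤-trans quad″≤ (ℕₚ.*-monoʳ-≤ A k′≤const″)
    ; lin′≤    = ℕₚ.≤-trans lin″≤ (ℕₚ.*-monoʳ-≤ A k′²≤const″)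
    ; 2≤r      = ℕₚ.≤-trans 2≤r (ℕₚ.≤-trans (ℕₚ.n≤1+n ρ) r<r′)
    ; N∣r      = N∣r′
    ; smooth   = λ cop → bezout-* (smooth-r′ cop) (smooth cop)
    ; smooth-r = smooth-r′
    }

  cubeMod-next : CubeMod N Q″
  cubeMod-next = cubeMod refl (∣n⇒∣m*n (lin Q) N∣r) (∣m⇒∣m*n (const Q′) (∣n⇒∣m*n (quad Q) N∣r))
    (∣m⇒∣m*n (const Q′) N∣r′)

  -- This is the start from two terms equal to 1: `u` is 1 and `v` is Q″ (1), which is dominated by
  -- its constant term. Of the factor 4 A + 3 of k′ ², the threshold of `growth` takes 2 A + 2, the
  -- middle coefficients 2 A, and the leading coefficient 1.
  point-seed : 4 · A ⊹ 3 ≤ₙ ρ → Point Q′ Q″ N (2 · (A · k′) ⊹ 2 ⊹ 0)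
  point-seed large = point 1ℤ w (divides (⟦ Q′ ⟧ w) (unitʳ (⟦ Q′ ⟧ w)) , ∣-refl)
    (bezout-next {N} {Q″} {1ℤ} {1ℤ} {w} cubeMod-next (1ℤ , 0ℤ , unit N) (sym (unitˡ w)))
    (ℕₚ.≤-trans (s≤s z≤n) (ℕₚ.≤-trans (ℕₚ.m≤n+m 2 (2 · (A · k′))) w≥)) (subst (_≤ₙ abs w) (sym (ℕₚ.+-identityʳ _)) w≥)
    where
    w = ⟦ Q″ ⟧ 1ℤ
    unit : ∀ N → 1ℤ * 1ℤ + 0ℤ * N ≡ 1ℤ
    unit = solve-∀
    unitʳ : ∀ m → m ≡ m * 1ℤ
    unitʳ = solve-∀
    unitˡ : ∀ m → m ≡ 1ℤ * m
    unitˡ = solve-∀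
    isolate : ∀ p q k → k ≡ (1ℤ * (1ℤ * 1ℤ * 1ℤ) + p * (1ℤ * 1ℤ) + q * 1ℤ + k) + - p + - q + - 1ℤ
    isolate = solve-∀
    spread : ∀ A k → (4 · A ⊹ 3) · (k · k) ≡ A · (k · k) ⊹ (2 · (A · (k · k)) ⊹ (k · k ⊹ k · k)) ⊹ (A · (k · k) ⊹ k · k)
    spread = ℕ-Solver.solve-∀
    regroup : ∀ W x y → W ⊹ x ⊹ y ⊹ 1 ≡ W ⊹ (y ⊹ (x ⊹ 1))
    regroup = ℕ-Solver.solve-∀
    collect : ∀ x y z → x ⊹ y ⊹ z ≡ y ⊹ (x ⊹ z)
    collect = ℕ-Solver.solve-∀
    1≤k′² : 1 ≤ₙ k′ · k′
    1≤k′² = ℕₚ.≤-trans (s≤s z≤n) (ℕₚ.≤-trans 2≤k′ k′≤k′²)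
    w≥ : 2 · (A · k′) ⊹ 2 ≤ₙ abs w
    w≥ = ℕₚ.+-cancelʳ-≤ (A · (k′ · k′) ⊹ (A · k′ ⊹ 1)) _ _ (begin
      (2 · (A · k′) ⊹ 2) ⊹ (A · (k′ · k′) ⊹ (A · k′ ⊹ 1))   ≡⟨ collect (A · (k′ · k′)) (2 · (A · k′) ⊹ 2) (A · k′ ⊹ 1) ⟨
      A · (k′ · k′) ⊹ (2 · (A · k′) ⊹ 2) ⊹ (A · k′ ⊹ 1)
        ≤⟨ ℕₚ.+-mono-≤ (ℕₚ.+-monoʳ-≤ (A · (k′ · k′)) (ℕₚ.+-mono-≤ (ℕₚ.*-monoʳ-≤ 2 (ℕₚ.*-monoʳ-≤ A k′≤k′²)) (ℕₚ.+-mono-≤ 1≤k′² 1≤k′²)))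
             (ℕₚ.+-mono-≤ (ℕₚ.*-monoʳ-≤ A k′≤k′²) 1≤k′²) ⟩
      A · (k′ · k′) ⊹ (2 · (A · (k′ · k′)) ⊹ (k′ · k′ ⊹ k′ · k′)) ⊹ (A · (k′ · k′) ⊹ k′ · k′) ≡⟨ spread A k′ ⟨
      (4 · A ⊹ 3) · (k′ · k′)                               ≤⟨ ℕₚ.*-monoˡ-≤ (k′ · k′) large ⟩
      ρ · (k′ · k′)                                         ≡⟨ abs-const″ ⟨
      abs (const Q″)                                        ≡⟨ cong abs (isolate (quad Q″) (lin Q″) (const Q″)) ⟩
      abs (w + - quad Q″ + - lin Q″ + - 1ℤ)                 ≤⟨ abs-+₄ w (- quad Q″) (- lin Q″) (- 1ℤ) ⟩
      abs w ⊹ abs (- quad Q″) ⊹ abs (- lin Q″) ⊹ 1          ≡⟨ cong₂ (λ x y → abs w ⊹ x ⊹ y ⊹ 1) (∣-i∣≡∣i∣ (quad Q″)) (∣-i∣≡∣i∣ (lin Q″)) ⟩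
      abs w ⊹ abs (quad Q″) ⊹ abs (lin Q″) ⊹ 1              ≤⟨ ℕₚ.+-monoˡ-≤ 1 (ℕₚ.+-mono-≤ (ℕₚ.+-monoʳ-≤ (abs w) quad″≤) lin″≤) ⟩
      abs w ⊹ A · k′ ⊹ A · (k′ · k′) ⊹ 1                    ≡⟨ regroup (abs w) (A · k′) (A · (k′ · k′)) ⟩
      abs w ⊹ (A · (k′ · k′) ⊹ (A · k′ ⊹ 1))                ∎)

bounded′ : ∀ {A N Q Q′ r} → 1 ≤ₙ A → Growing A N Q Q′ r → Bounded (A · abs (const Q′)) Q′
bounded′ {A} {Q′ = Q′} 1≤A g = bounded monic′ quad′≤ lin′≤
  (subst (_≤ₙ A · abs (const Q′)) (ℕₚ.*-identityˡ _) (ℕₚ.*-monoˡ-≤ (abs (const Q′)) 1≤A))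
  where open Growing g

-- `d` has two roles. It bounds the number of cubics to climb until `r` is large enough for a seed,
-- and it is the excess over the threshold gained on the way down, where each doubling contributes
-- at least one.
growing⇒point : ∀ {A N} → 1 ≤ₙ A → ∀ d Q Q′ r → Growing A N Q Q′ r → 4 · A ⊹ 3 ≤ₙ abs r ⊹ d →
  Point Q′ (reflect r (const Q′) Q) N (2 · (A · abs (const Q′)) ⊹ 2 ⊹ d)
growing⇒point 1≤A zero Q Q′ r g large = point-seed g (subst (_ ≤ₙ_) (ℕₚ.+-identityʳ (abs r)) large)
growing⇒point {A} {N} 1≤A (suc d) Q Q′ r g large =
  weaken (point-next Q′ Q″ {r′} refl (Growing.smooth g′) (λ cop → cop) (cubeMod-next g) (bounded′ 1≤A g′)
    (ℕₚ.m≤m+n _ d)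
    (growing⇒point 1≤A d Q′ Q″ r′ g′ (ℕₚ.≤-trans (subst (4 · A ⊹ 3 ≤ₙ_) (ℕₚ.+-suc (abs r) d) large) (ℕₚ.+-monoˡ-≤ d (r<r′ g)))))
  where
  open ℕₚ.≤-Reasoning
  Q″ = reflect r (const Q′) Q
  r′ = lead Q * const Q′ * r
  g′ : Growing A N Q′ Q″ r′
  g′ = growing-next g
  K″ = 2 · (A · abs (const Q″))
  identity : ∀ K d → K ⊹ 2 ⊹ suc d ⊹ (K ⊹ suc d) ≡ 2 · (K ⊹ 2 ⊹ d)
  identity = ℕ-Solver.solve-∀
  k′≤k″ : abs (const Q′) ≤ₙ abs (const Q″)
  k′≤k″ = begin
    abs (const Q′)             ≡⟨ ℕₚ.*-identityˡ _ ⟨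
    1 · abs (const Q′)         ≤⟨ ℕₚ.*-monoˡ-≤ (abs (const Q′)) (ℕₚ.≤-trans (s≤s z≤n) (Growing.2≤r g′)) ⟩
    abs r′ · abs (const Q′)    ≡⟨ abs-* r′ (const Q′) ⟨
    abs (const Q″)             ∎
  weaken : Point Q′ Q″ N (2 · (K″ ⊹ 2 ⊹ d)) → Point Q′ Q″ N (2 · (A · abs (const Q′)) ⊹ 2 ⊹ suc d)
  weaken (point u v l cop u≤v b≤v) = point u v l cop u≤v (begin
    2 · (A · abs (const Q′)) ⊹ 2 ⊹ suc d  ≤⟨ ℕₚ.+-monoˡ-≤ (suc d) (ℕₚ.+-monoˡ-≤ 2 (ℕₚ.*-monoʳ-≤ 2 (ℕₚ.*-monoʳ-≤ A k′≤k″))) ⟩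
    K″ ⊹ 2 ⊹ suc d                        ≤⟨ ℕₚ.m≤m+n _ (K″ ⊹ suc d) ⟩
    K″ ⊹ 2 ⊹ suc d ⊹ (K″ ⊹ suc d)         ≡⟨ identity K″ d ⟩
    2 · (K″ ⊹ 2 ⊹ d)                      ≤⟨ b≤v ⟩
    abs v                                 ∎)

unbounded-nonunit : ∀ a b a₁ a₂ b₁ b₂ c → 1 ≤ₙ abs a → 1 ≤ₙ abs b → 1 ≤ₙ abs c → 2 ≤ₙ abs a · (abs b · abs c) →
  Unbounded (IsSolution a b a₁ a₂ b₁ b₂ c)
unbounded-nonunit a b a₁ a₂ b₁ b₂ c 1≤a 1≤b 1≤c 2≤abc B = weaken
  (point⇒solution (λ cop → bezout-* cop (bezout-∣ c∣r₀ cop)) bounded₁ big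
    -- `Q₂` need not be t ³ modulo the primes of `a`, so the modulus drops from `r₁` to `r₀`. That
    -- suffices, because `const Q₁` is `r₀ * c` and `c` divides `r₀`.
    (point-next Q₁ Q₂ {r₁} refl smooth (bezout-∣ r₀∣r₁) cube (bounded′ 1≤A growing) (ℕₚ.m≤m+n _ d)
      (growing⇒point 1≤A d Q₁ Q₂ r₁ growing (ℕₚ.≤-trans (ℕₚ.m≤n+m _ B) (ℕₚ.m≤n+m d (abs r₁))))))
  where
  open ℕₚ.≤-Reasoning
  open Start a b a₁ a₂ b₁ b₂ c
  r₀ r₁ : ℤ
  r₀ = b * c * 1ℤ
  r₁ = a * const Q₁ * r₀
  A d m₁ m₂ : ℕ
  A = suc (abs (quad Q₁) ⊹ abs (lin Q₁) ⊹ abs (quad Q₂) ⊹ abs (lin Q₂))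
  -- `B` makes the solution large, 4 A + 3 guarantees that the climb ends at a seed.
  d = B ⊹ (4 · A ⊹ 3)
  m₁ = abs (const Q₁)
  m₂ = abs (const Q₂)
  1≤A : 1 ≤ₙ A
  1≤A = s≤s z≤n
  r₀∣r₁ : r₀ ∣ r₁
  r₀∣r₁ = divides (a * const Q₁) refl
  c∣r₀ : c ∣ r₀
  c∣r₀ = divides b (*-identityʳ (b * c))
  abs-r₀ : abs r₀ ≡ abs b · abs c
  abs-r₀ = trans (cong abs (*-identityʳ (b * c))) (abs-* b c)
  1≤r₀ : 1 ≤ₙ abs r₀
  1≤r₀ = subst (1 ≤ₙ_) (sym abs-r₀) (ℕₚ.*-mono-≤ 1≤b 1≤c)
  1≤m₁ : 1 ≤ₙ m₁
  1≤m₁ = subst (1 ≤ₙ_) (sym (abs-* r₀ c)) (ℕₚ.*-mono-≤ 1≤r₀ 1≤c)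
  -- This is where ∣ a b c ∣ ≥ 2 enters: `r₁` is a b c times `const Q₁`.
  2≤r₁ : 2 ≤ₙ abs r₁
  2≤r₁ = begin
    2 · 1                                    ≤⟨ ℕₚ.*-mono-≤ 2≤abc 1≤m₁ ⟩
    abs a · (abs b · abs c) · m₁             ≡⟨ rotate (abs a) (abs b · abs c) m₁ ⟩
    abs a · m₁ · (abs b · abs c)             ≡⟨ cong (abs a · m₁ ·_) abs-r₀ ⟨
    abs a · m₁ · abs r₀                      ≡⟨ cong (_· abs r₀) (abs-* a (const Q₁)) ⟨
    abs (a * const Q₁) · abs r₀              ≡⟨ abs-* (a * const Q₁) r₀ ⟨
    abs r₁                                   ∎
    where
    rotate : ∀ x y z → x · y · z ≡ x · z · y
    rotate = ℕ-Solver.solve-∀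
  m₁≤m₂ : m₁ ≤ₙ m₂
  m₁≤m₂ = begin
    m₁            ≡⟨ ℕₚ.*-identityˡ m₁ ⟨
    1 · m₁        ≤⟨ ℕₚ.*-monoˡ-≤ m₁ (ℕₚ.≤-trans (s≤s z≤n) 2≤r₁) ⟩
    abs r₁ · m₁   ≡⟨ abs-* r₁ (const Q₁) ⟨
    m₂            ∎
  smooth : ∀ {v} → Bezout v r₁ → Bezout v (const Q₂)
  smooth cop = bezout-* cop (bezout-∣ (∣m⇒∣m*n r₀ (∣n⇒∣m*n a ∣-refl)) cop)
  cube : CubeMod r₀ Q₂
  cube = cubeMod refl (∣n⇒∣m*n a₁ ∣-refl) (∣m⇒∣m*n (const Q₁) (∣n⇒∣m*n a₂ ∣-refl)) (∣m⇒∣m*n (const Q₁) r₀∣r₁)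
  scaled : ∀ {x m} → x ≤ₙ A → 1 ≤ₙ m → x ≤ₙ A · m
  scaled {x} {m} x≤A 1≤m = ℕₚ.≤-trans x≤A (subst (_≤ₙ A · m) (ℕₚ.*-identityʳ A) (ℕₚ.*-monoʳ-≤ A 1≤m))
  w₁ : abs (quad Q₁) ≤ₙ A
  w₁ = ℕₚ.≤-trans (ℕₚ.≤-trans (ℕₚ.≤-trans (ℕₚ.m≤m+n _ (abs (lin Q₁))) (ℕₚ.m≤m+n _ (abs (quad Q₂)))) (ℕₚ.m≤m+n _ (abs (lin Q₂)))) (ℕₚ.n≤1+n _)
  w₂ : abs (lin Q₁) ≤ₙ A
  w₂ = ℕₚ.≤-trans (ℕₚ.≤-trans (ℕₚ.≤-trans (ℕₚ.m≤n+m _ (abs (quad Q₁))) (ℕₚ.m≤m+n _ (abs (quad Q₂)))) (ℕₚ.m≤m+n _ (abs (lin Q₂)))) (ℕₚ.n≤1+n _)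
  w₃ : abs (quad Q₂) ≤ₙ A
  w₃ = ℕₚ.≤-trans (ℕₚ.≤-trans (ℕₚ.m≤n+m _ (abs (quad Q₁) ⊹ abs (lin Q₁))) (ℕₚ.m≤m+n _ (abs (lin Q₂)))) (ℕₚ.n≤1+n _)
  w₄ : abs (lin Q₂) ≤ₙ A
  w₄ = ℕₚ.≤-trans (ℕₚ.m≤n+m _ (abs (quad Q₁) ⊹ abs (lin Q₁) ⊹ abs (quad Q₂))) (ℕₚ.n≤1+n _)
  growing : Growing A r₁ Q₁ Q₂ r₁
  growing = record
    { monic    = refl
    ; monic′   = refl
    ; const≡   = refl
    ; 1≤const  = 1≤m₁
    ; quad≤    = scaled w₁ 1≤m₁
    ; lin≤     = scaled w₂ 1≤m₁
    ; quad′≤   = scaled w₃ (ℕₚ.≤-trans 1≤m₁ m₁≤m₂)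
    ; lin′≤    = scaled w₄ (ℕₚ.≤-trans 1≤m₁ m₁≤m₂)
    ; 2≤r      = 2≤r₁
    ; N∣r      = ∣-refl
    ; smooth   = smooth
    ; smooth-r = λ cop → cop
    }
  bounded₁ : Bounded (A · m₁) Q₁
  bounded₁ = bounded refl (scaled w₁ 1≤m₁) (scaled w₂ 1≤m₁)
    (subst (_≤ₙ A · m₁) (ℕₚ.*-identityˡ m₁) (ℕₚ.*-monoˡ-≤ m₁ 1≤A))
  E₂ : ℕ
  E₂ = 2 · (A · m₂) ⊹ 2 ⊹ d
  big : 2 · (A · m₁) ⊹ 2 ≤ₙ 2 · E₂
  big = begin
    2 · (A · m₁) ⊹ 2  ≤⟨ ℕₚ.+-monoˡ-≤ 2 (ℕₚ.*-monoʳ-≤ 2 (ℕₚ.*-monoʳ-≤ A m₁≤m₂)) ⟩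
    2 · (A · m₂) ⊹ 2  ≤⟨ ℕₚ.m≤m+n _ d ⟩
    E₂                ≤⟨ ℕₚ.m≤m+n E₂ _ ⟩
    2 · E₂            ∎
  weaken : (∃ λ s → IsSolution a b a₁ a₂ b₁ b₂ c s × 2 · E₂ ≤ₙ size s) →
    ∃ λ s → IsSolution a b a₁ a₂ b₁ b₂ c s × B ≤ₙ size s
  weaken (s , sol , large) = s , sol , (begin
    B        ≤⟨ ℕₚ.m≤m+n B (4 · A ⊹ 3) ⟩
    d        ≤⟨ ℕₚ.m≤n+m d (2 · (A · m₂) ⊹ 2) ⟩
    E₂       ≤⟨ ℕₚ.m≤m+n E₂ _ ⟩
    2 · E₂   ≤⟨ large ⟩
    size s   ∎)

-- The case ∣ a b c ∣ = 1

unit : ℤ → ℤ → Cubic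
unit p q = ⟨ 1ℤ , p , q , 1ℤ ⟩

-- Reflection now merely exchanges the middle coefficients. It is an involution linking cubics two
-- places apart, whence the period 4.
reflect-unit : ∀ p q → reflect 1ℤ 1ℤ (unit p q) ≡ unit q p
reflect-unit p q = cong₂ unit (*-identityʳ q) (trans (*-identityʳ (p * 1ℤ)) (*-identityʳ p))

1∣ : ∀ m → 1ℤ ∣ m
1∣ m = divides m (sym (*-identityʳ m))

bezout-1 : ∀ v → Bezout v 1ℤ
bezout-1 v = 0ℤ , 1ℤ , identity v
  where
  identity : ∀ v → 0ℤ * v + 1ℤ * 1ℤ ≡ 1ℤ
  identity = solve-∀

-- All constant terms are 1, so modulus 1 will do; `d` is the excess over the threshold 2 M + 2 of
-- `growth`.
Chain : ℕ → ℤ → ℤ → ℤ → ℤ → ℕ → Set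
Chain M p q p′ q′ d = Point (unit p q) (unit p′ q′) 1ℤ (2 · M ⊹ 2 ⊹ d)

chain-weaken : ∀ {M p q p′ q′ d e} → d ≤ₙ e → Chain M p q p′ q′ e → Chain M p q p′ q′ d
chain-weaken {M} d≤e (point u v l cop u≤v b≤v) = point u v l cop u≤v (ℕₚ.≤-trans (ℕₚ.+-monoʳ-≤ (2 · M ⊹ 2) d≤e) b≤v)

module _ {M : ℕ} (1≤M : 1 ≤ₙ M) where
  open ℕₚ.≤-Reasoning

  -- One step down: the preceding cubic is `unit q′ p′`, the one whose reflection is `unit p′ q′`.
  -- Doubling raises the excess by at least one.
  chain-turn : ∀ {p q p′ q′ d} → abs p ≤ₙ M → abs q ≤ₙ M → Chain M p q p′ q′ d → Chain M q′ p′ p q (suc d)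
  chain-turn {p} {q} {p′} {q′} {d} p≤ q≤ pt = weaken
    (point-next (unit q′ p′) (unit p q) {1ℤ} refl (λ cop → cop) (λ cop → cop)
      (cubeMod refl (1∣ p) (1∣ q) (1∣ 1ℤ)) (bounded refl p≤ q≤ 1≤M) (ℕₚ.m≤m+n _ d)
      (subst (λ Q → Point (unit p q) Q 1ℤ (2 · M ⊹ 2 ⊹ d)) (sym (reflect-unit q′ p′)) pt))
    where
    identity : ∀ m d → 2 · m ⊹ 2 ⊹ suc d ⊹ (2 · m ⊹ suc d) ≡ 2 · (2 · m ⊹ 2 ⊹ d)
    identity = ℕ-Solver.solve-∀
    weaken : Point (unit q′ p′) (unit p q) 1ℤ (2 · (2 · M ⊹ 2 ⊹ d)) → Chain M q′ p′ p q (suc d)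
    weaken (point u v l cop u≤v b≤v) = point u v l cop u≤v (begin
      2 · M ⊹ 2 ⊹ suc d                      ≤⟨ ℕₚ.m≤m+n _ (2 · M ⊹ suc d) ⟩
      2 · M ⊹ 2 ⊹ suc d ⊹ (2 · M ⊹ suc d)    ≡⟨ identity M d ⟩
      2 · (2 · M ⊹ 2 ⊹ d)                    ≤⟨ b≤v ⟩
      abs v                                  ∎)

  module _ {p q p′ q′} (p≤ : abs p ≤ₙ M) (q≤ : abs q ≤ₙ M) (p′≤ : abs p′ ≤ₙ M) (q′≤ : abs q′ ≤ₙ M) where
    chain-all : Chain M p q p′ q′ 0 → ∀ d → Chain M p q p′ q′ d
    chain-all ch zero = ch
    -- Four turns restore the pair of cubics and raise the excess by four, of which one is kept.
    chain-all ch (suc d) = chain-weaken {M} (s≤s (ℕₚ.m≤n+m d 3))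
      (chain-turn p′≤ q′≤ (chain-turn q≤ p≤ (chain-turn q′≤ p′≤ (chain-turn p≤ q≤ (chain-all ch d)))))

-- The values at 1 and -1 have sum 2 p + 2 and difference 2 q + 2.
values-bound : ∀ {K} p q → abs (⟦ unit p q ⟧ 1ℤ) ≤ₙ K → abs (⟦ unit p q ⟧ -1ℤ) ≤ₙ K →
  abs p ≤ₙ suc K × abs q ≤ₙ suc K
values-bound {K} p q ≤₊ ≤₋ = ℕₚ.*-cancelˡ-≤ 2 2p≤ , ℕₚ.*-cancelˡ-≤ 2 2q≤
  where
  open ℕₚ.≤-Reasoning
  V₊ V₋ : ℤ
  V₊ = ⟦ unit p q ⟧ 1ℤ
  V₋ = ⟦ unit p q ⟧ -1ℤ
  addition : ∀ p q → + 2 * p ≡ (1ℤ * 1ℤ + p * 1ℤ + q * 1ℤ + 1ℤ) + (1ℤ * -1ℤ + p * 1ℤ + q * -1ℤ + 1ℤ) + - 1ℤ + - 1ℤ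
  addition = solve-∀
  difference : ∀ p q → + 2 * q ≡ (1ℤ * 1ℤ + p * 1ℤ + q * 1ℤ + 1ℤ) + - (1ℤ * -1ℤ + p * 1ℤ + q * -1ℤ + 1ℤ) + - 1ℤ + - 1ℤ
  difference = solve-∀
  collect : ∀ K → K ⊹ K ⊹ 1 ⊹ 1 ≡ 2 · suc K
  collect = ℕ-Solver.solve-∀
  total : ∀ i → abs i ≤ₙ K → abs (V₊ + i + - 1ℤ + - 1ℤ) ≤ₙ 2 · suc K
  total i i≤ = begin
    abs (V₊ + i + - 1ℤ + - 1ℤ)  ≤⟨ abs-+₄ V₊ i (- 1ℤ) (- 1ℤ) ⟩
    abs V₊ ⊹ abs i ⊹ 1 ⊹ 1      ≤⟨ ℕₚ.+-monoˡ-≤ 1 (ℕₚ.+-monoˡ-≤ 1 (ℕₚ.+-mono-≤ ≤₊ i≤)) ⟩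
    K ⊹ K ⊹ 1 ⊹ 1               ≡⟨ collect K ⟩
    2 · suc K                   ∎
  2p≤ : 2 · abs p ≤ₙ 2 · suc K
  2p≤ = begin
    2 · abs p                    ≡⟨ abs-* (+ 2) p ⟨
    abs (+ 2 * p)                ≡⟨ cong abs (addition p q) ⟩
    abs (V₊ + V₋ + - 1ℤ + - 1ℤ)  ≤⟨ total V₋ ≤₋ ⟩
    2 · suc K                    ∎
  2q≤ : 2 · abs q ≤ₙ 2 · suc K
  2q≤ = begin
    2 · abs q                      ≡⟨ abs-* (+ 2) q ⟨
    abs (+ 2 * q)                  ≡⟨ cong abs (difference p q) ⟩
    abs (V₊ + - V₋ + - 1ℤ + - 1ℤ)  ≤⟨ total (- V₋) (subst (_≤ₙ K) (sym (∣-i∣≡∣i∣ V₋)) ≤₋) ⟩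
    2 · suc K                      ∎

-- The values of the cubic at k and - k differ by 2 k (k ² + q), so one of them is large.
signed-value : ∀ p q k → ∃ λ v → (v ∣ k × abs v ≡ abs k) × abs k · abs (k * k + q) ≤ₙ abs (⟦ unit p q ⟧ v)
signed-value p q k = choose (ℕₚ.≤-total X (abs (⟦ unit p q ⟧ k))) (ℕₚ.≤-total X (abs (⟦ unit p q ⟧ (- k))))
  where
  open ℕₚ.≤-Reasoning
  X = abs k · abs (k * k + q)
  identity : ∀ p q k → + 2 * (k * (k * k + q))
    ≡ (1ℤ * (k * k * k) + p * (k * k) + q * k + 1ℤ) + - (1ℤ * (- k * - k * - k) + p * (- k * - k) + q * - k + 1ℤ)
  identity = solve-∀
  negate : ∀ k → k ≡ - 1ℤ * - k
  negate = solve-∀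
  double : ∀ X → 2 · X ≡ X ⊹ X
  double = ℕ-Solver.solve-∀
  sum≥ : X ⊹ X ≤ₙ abs (⟦ unit p q ⟧ k) ⊹ abs (⟦ unit p q ⟧ (- k))
  sum≥ = begin
    X ⊹ X                                                  ≡⟨ double X ⟨
    2 · X                                                  ≡⟨ cong (2 ·_) (abs-* k (k * k + q)) ⟨
    2 · abs (k * (k * k + q))                              ≡⟨ abs-* (+ 2) (k * (k * k + q)) ⟨
    abs (+ 2 * (k * (k * k + q)))                          ≡⟨ cong abs (identity p q k) ⟩
    abs (⟦ unit p q ⟧ k + - ⟦ unit p q ⟧ (- k))            ≤⟨ ∣i+j∣≤∣i∣+∣j∣ (⟦ unit p q ⟧ k) (- ⟦ unit p q ⟧ (- k)) ⟩
    abs (⟦ unit p q ⟧ k) ⊹ abs (- ⟦ unit p q ⟧ (- k))      ≡⟨ cong (abs (⟦ unit p q ⟧ k) ⊹_) (∣-i∣≡∣i∣ (⟦ unit p q ⟧ (- k))) ⟩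
    abs (⟦ unit p q ⟧ k) ⊹ abs (⟦ unit p q ⟧ (- k))        ∎
  choose : X ≤ₙ abs (⟦ unit p q ⟧ k) ⊎ abs (⟦ unit p q ⟧ k) ≤ₙ X →
    X ≤ₙ abs (⟦ unit p q ⟧ (- k)) ⊎ abs (⟦ unit p q ⟧ (- k)) ≤ₙ X →
    ∃ λ v → (v ∣ k × abs v ≡ abs k) × X ≤ₙ abs (⟦ unit p q ⟧ v)
  choose (inj₁ le) _ = k , (∣-refl , refl) , le
  choose (inj₂ _) (inj₁ le) = - k , (divides (- 1ℤ) (negate k) , ∣-i∣≡∣i∣ k) , le
  -- The value at `k` contributes at most `X` to a sum of at least 2 X, so the value at `- k`
  -- contributes at least `X`.
  choose (inj₂ ge) (inj₂ _) = - k , (divides (- 1ℤ) (negate k) , ∣-i∣≡∣i∣ k) ,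
    ℕₚ.+-cancelˡ-≤ X _ _ (ℕₚ.≤-trans sum≥ (ℕₚ.+-monoˡ-≤ _ ge))

-- The pair ε, ±k is linked, but ∣ k ∣ = K may lie below the threshold 2 (K + 1) + 2. One further
-- step, with the sign from `signed-value`, reaches at least K ∣ k ² + q ∣ ≥ 5 K, which is enough
-- for K ≥ 3.
chain-seed : ∀ p q p′ q′ ε → ε * ε ≡ 1ℤ → 3 ≤ₙ abs (⟦ unit p′ q′ ⟧ ε) →
  abs q ≤ₙ suc (abs (⟦ unit p′ q′ ⟧ ε)) → Chain (suc (abs (⟦ unit p′ q′ ⟧ ε))) q′ p′ p q 0
chain-seed p q p′ q′ ε ε²≡1 3≤K q≤ = build (signed-value p q k)
  where
  open ℕₚ.≤-Reasoning
  k = ⟦ unit p′ q′ ⟧ ε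
  K = abs k
  X = abs (k * k + q)
  isolate : ∀ k q → k * k ≡ k * k + q + - q
  isolate = solve-∀
  K²≤ : K · K ≤ₙ X ⊹ suc K
  K²≤ = begin
    K · K                    ≡⟨ abs-* k k ⟨
    abs (k * k)              ≡⟨ cong abs (isolate k q) ⟩
    abs (k * k + q + - q)    ≤⟨ ∣i+j∣≤∣i∣+∣j∣ (k * k + q) (- q) ⟩
    X ⊹ abs (- q)            ≡⟨ cong (X ⊹_) (∣-i∣≡∣i∣ q) ⟩
    X ⊹ abs q                ≤⟨ ℕₚ.+-monoʳ-≤ X q≤ ⟩
    X ⊹ suc K                ∎
  5≤X : 5 ≤ₙ X
  5≤X = ℕₚ.+-cancelʳ-≤ (suc K) 5 X (begin
    5 ⊹ suc K          ≡⟨ ℕₚ.+-suc 5 K ⟩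
    3 ⊹ 3 ⊹ K          ≤⟨ ℕₚ.+-monoˡ-≤ K (ℕₚ.+-mono-≤ 3≤K 3≤K) ⟩
    K ⊹ K ⊹ K          ≡⟨ triple K ⟩
    3 · K              ≤⟨ ℕₚ.*-monoˡ-≤ K 3≤K ⟩
    K · K              ≤⟨ K²≤ ⟩
    X ⊹ suc K          ∎)
    where
    triple : ∀ K → K ⊹ K ⊹ K ≡ 3 · K
    triple = ℕ-Solver.solve-∀
  large : 2 · suc K ⊹ 2 ⊹ 0 ≤ₙ K · X
  large = begin
    2 · suc K ⊹ 2 ⊹ 0  ≡⟨ expand K ⟩
    4 ⊹ 2 · K          ≤⟨ ℕₚ.+-monoˡ-≤ (2 · K) (ℕₚ.≤-trans (toWitness {a? = 4 ≤? 9} tt) (ℕₚ.*-monoʳ-≤ 3 3≤K)) ⟩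
    3 · K ⊹ 2 · K      ≡⟨ collect K ⟩
    K · 5              ≤⟨ ℕₚ.*-monoʳ-≤ K 5≤X ⟩
    K · X              ∎
    where
    expand : ∀ K → 2 · suc K ⊹ 2 ⊹ 0 ≡ 4 ⊹ 2 · K
    expand = ℕ-Solver.solve-∀
    collect : ∀ K → 3 · K ⊹ 2 · K ≡ K · 5
    collect = ℕ-Solver.solve-∀
  abs-ε : abs ε ≡ 1
  abs-ε = ℕₚ.m*n≡1⇒m≡1 (abs ε) (abs ε) (trans (sym (abs-* ε ε)) (cong abs ε²≡1))
  build : (∃ λ v → (v ∣ k × abs v ≡ K) × K · X ≤ₙ abs (⟦ unit p q ⟧ v)) → Chain (suc K) q′ p′ p q 0
  build (v , (v∣k , v≡K) , le) = point v w
    (linked-next (unit q′ p′) (unit p q) {1ℤ} {ε} {v} {w} refl linked (bezout-1 v) εw≡)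
    (bezout-1 w) v≤w (ℕₚ.≤-trans large KX≤w)
    where
    y w : ℤ
    y = ⟦ unit p q ⟧ v
    w = ε * y
    εw≡ : ε * w ≡ y
    εw≡ = trans (sym (assoc ε y)) (trans (cong (_* y) ε²≡1) (*-identityˡ y))
      where
      assoc : ∀ ε y → ε * ε * y ≡ ε * (ε * y)
      assoc = solve-∀
    linked : Linked (unit p q) (reflect 1ℤ 1ℤ (unit q′ p′)) ε v
    linked = divides w (trans (sym εw≡) (*-comm ε w)) , subst (λ Q → v ∣ ⟦ Q ⟧ ε) (sym (reflect-unit q′ p′)) v∣k
    KX≤w : K · X ≤ₙ abs w
    KX≤w = begin
      K · X           ≤⟨ le ⟩
      abs y           ≡⟨ ℕₚ.*-identityˡ (abs y) ⟨
      1 · abs y       ≡⟨ cong (_· abs y) abs-ε ⟨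
      abs ε · abs y   ≡⟨ abs-* ε y ⟨
      abs w           ∎
    v≤w : abs v ≤ₙ abs w
    v≤w = begin
      abs v     ≡⟨ v≡K ⟩
      K         ≡⟨ ℕₚ.*-identityʳ K ⟨
      K · 1     ≤⟨ ℕₚ.*-monoʳ-≤ K (ℕₚ.≤-trans (s≤s z≤n) 5≤X) ⟩
      K · X     ≤⟨ KX≤w ⟩
      abs w     ∎

module Orbit {M} (1≤M : 1 ≤ₙ M) {b₁ b₂ a₁ a₂}
  (b₁≤ : abs b₁ ≤ₙ M) (b₂≤ : abs b₂ ≤ₙ M) (a₁≤ : abs a₁ ≤ₙ M) (a₂≤ : abs a₂ ≤ₙ M) where

  -- The index counts the turns by which a pair of cubics lies beyond the first pair; completing the
  -- period leads back to it.
  from₀ : Chain M b₁ b₂ a₁ a₂ 0 → ∀ d → Chain M b₁ b₂ a₁ a₂ d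
  from₀ = chain-all 1≤M b₁≤ b₂≤ a₁≤ a₂≤

  from₃ : Chain M a₁ a₂ b₂ b₁ 0 → ∀ d → Chain M b₁ b₂ a₁ a₂ d
  from₃ ch = from₀ (chain-weaken {M} z≤n (chain-turn 1≤M a₁≤ a₂≤ ch))

  from₂ : Chain M b₂ b₁ a₂ a₁ 0 → ∀ d → Chain M b₁ b₂ a₁ a₂ d
  from₂ ch = from₃ (chain-weaken {M} z≤n (chain-turn 1≤M b₂≤ b₁≤ ch))

  from₁ : Chain M a₂ a₁ b₁ b₂ 0 → ∀ d → Chain M b₁ b₂ a₁ a₂ d
  from₁ ch = from₂ (chain-weaken {M} z≤n (chain-turn 1≤M a₂≤ a₁≤ ch))

-- The finitely many cubics with values ±1 or ±2 at both 1 and -1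

Proper : ℤ × ℤ → Set
Proper (p , q) = (1 ≤ₙ abs (⟦ unit p q ⟧ 1ℤ) × abs (⟦ unit p q ⟧ 1ℤ) ≤ₙ 2)
  × (1 ≤ₙ abs (⟦ unit p q ⟧ -1ℤ) × abs (⟦ unit p q ⟧ -1ℤ) ≤ₙ 2)

proper? : ∀ f → Dec (Proper f)
proper? (p , q) = ((1 ≤? _) ×-dec (_ ≤? 2)) ×-dec ((1 ≤? _) ×-dec (_ ≤? 2))

-- By `values-bound` with K = 2, these are the possible middle coefficients of a proper cubic.
range : List ℤ
range = -[1+ 2 ] ∷ -[1+ 1 ] ∷ -[1+ 0 ] ∷ + 0 ∷ + 1 ∷ + 2 ∷ + 3 ∷ []

∈-range : ∀ p → abs p ≤ₙ 3 → p ∈ range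
∈-range -[1+ 2 ] _ = here refl
∈-range -[1+ 1 ] _ = there (here refl)
∈-range -[1+ 0 ] _ = there (there (here refl))
∈-range (+ 0) _ = there (there (there (here refl)))
∈-range (+ 1) _ = there (there (there (there (here refl))))
∈-range (+ 2) _ = there (there (there (there (there (here refl)))))
∈-range (+ 3) _ = there (there (there (there (there (there (here refl))))))
∈-range (+ suc (suc (suc (suc _)))) (s≤s (s≤s (s≤s ())))
∈-range -[1+ suc (suc (suc _)) ] (s≤s (s≤s (s≤s ())))

propers : List (ℤ × ℤ)
propers = filter proper? (cartesianProduct range range)

∈-propers : ∀ f → Proper f → f ∈ propers
∈-propers (p , q) pr@((_ , ≤₊) , (_ , ≤₋)) =
  ∈-filter⁺ proper? (∈-cartesianProduct⁺ (∈-range p (proj₁ bd)) (∈-range q (proj₂ bd))) pr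
  where
  bd : abs p ≤ₙ 3 × abs q ≤ₙ 3
  bd = values-bound p q ≤₊ ≤₋

State : Set
State = (ℤ × ℤ) × (ℤ × ℤ)

orbit : State → List State
orbit ((b₁ , b₂) , (a₁ , a₂)) =
  ((b₁ , b₂) , (a₁ , a₂)) ∷ ((a₂ , a₁) , (b₁ , b₂)) ∷ ((b₂ , b₁) , (a₂ , a₁)) ∷ ((a₁ , a₂) , (b₂ , b₁)) ∷ []

-- 8 is the threshold 2 M + 2 for M = 3.
Seed : State → ℤ × ℤ → Set
Seed ((p , q) , (p′ , q′)) (u , v) = Linked (unit p q) (unit p′ q′) u v × (abs u ≤ₙ abs v × 8 ≤ₙ abs v)

seed? : ∀ s uv → Dec (Seed s uv)
seed? ((p , q) , (p′ , q′)) (u , v) =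
  ((u ∣? ⟦ unit p q ⟧ v) ×-dec (v ∣? ⟦ unit p′ q′ ⟧ u)) ×-dec ((abs u ≤? abs v) ×-dec (8 ≤? abs v))

-- Found by a computer search over small u.
seeds : List (ℤ × ℤ)
seeds = (- + 2 , + 13) ∷ (- + 2 , + 11) ∷ (+ 5 , + 13) ∷ (- + 5 , + 13) ∷ (+ 10 , + 13) ∷ (- + 5 , - + 17)
  ∷ (- + 41 , + 97) ∷ []

Seeded : State → Set
Seeded s = Any (λ t → Any (Seed t) seeds) (orbit s)

-- Decided by evaluation: the eight proper cubics form 64 states, and each has a fitting seed at one
-- of the four places of its period.
all-seeded : All Seeded (cartesianProduct propers propers)
all-seeded = toWitness {a? = all? (λ s → any? (λ t → any? (seed? t) seeds) (orbit s)) (cartesianProduct propers propers)} tt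

seed⇒chain : ∀ {p q p′ q′} l → Any (Seed ((p , q) , (p′ , q′))) l → Chain 3 p q p′ q′ 0
seed⇒chain ((u , v) ∷ _) (here (linked , u≤v , 8≤v)) = point u v linked (bezout-1 v) u≤v 8≤v
seed⇒chain (_ ∷ l) (there any) = seed⇒chain l any

proper⇒chain : ∀ b₁ b₂ a₁ a₂ → Proper (b₁ , b₂) → Proper (a₁ , a₂) → ∀ d → Chain 3 b₁ b₂ a₁ a₂ d
proper⇒chain b₁ b₂ a₁ a₂ pr@((_ , b₊) , (_ , b₋)) pr′@((_ , a₊) , (_ , a₋)) =
  start (lookup all-seeded (∈-cartesianProduct⁺ (∈-propers (b₁ , b₂) pr) (∈-propers (a₁ , a₂) pr′)))
  where
  b≤ : abs b₁ ≤ₙ 3 × abs b₂ ≤ₙ 3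
  b≤ = values-bound b₁ b₂ b₊ b₋
  a≤ : abs a₁ ≤ₙ 3 × abs a₂ ≤ₙ 3
  a≤ = values-bound a₁ a₂ a₊ a₋
  open Orbit {3} (s≤s z≤n) {b₁} {b₂} {a₁} {a₂} (proj₁ b≤) (proj₂ b≤) (proj₁ a≤) (proj₂ a≤)
  start : Seeded ((b₁ , b₂) , (a₁ , a₂)) → ∀ d → Chain 3 b₁ b₂ a₁ a₂ d
  start (here any) = from₀ (seed⇒chain seeds any)
  start (there (here any)) = from₁ (seed⇒chain seeds any)
  start (there (there (here any))) = from₂ (seed⇒chain seeds any)
  start (there (there (there (here any)))) = from₃ (seed⇒chain seeds any)
  start (there (there (there (there ()))))

-- Arbitrarily large chains when no value at ±1 vanishes

record Unlimited (b₁ b₂ a₁ a₂ : ℤ) : Set where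
  field
    M     : ℕ
    1≤M   : 1 ≤ₙ M
    b₁≤   : abs b₁ ≤ₙ M
    b₂≤   : abs b₂ ≤ₙ M
    chain : ∀ d → Chain M b₁ b₂ a₁ a₂ d

-- The maximum has to be attained: `K` must bound all coefficients through `values-bound` and also
-- be the value from which `chain-seed` starts.
max₄ : ∀ w x y z → ∃ λ K → ((w ≤ₙ K × x ≤ₙ K) × (y ≤ₙ K × z ≤ₙ K)) × ((K ≡ w ⊎ K ≡ x) ⊎ (K ≡ y ⊎ K ≡ z))
max₄ w x y z = (w ⊔ x) ⊔ (y ⊔ z) ,
  ((ℕₚ.≤-trans (ℕₚ.m≤m⊔n w x) l , ℕₚ.≤-trans (ℕₚ.m≤n⊔m w x) l) ,
   (ℕₚ.≤-trans (ℕₚ.m≤m⊔n y z) r , ℕₚ.≤-trans (ℕₚ.m≤n⊔m y z) r)) ,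
  pick (ℕₚ.⊔-sel (w ⊔ x) (y ⊔ z))
  where
  l : w ⊔ x ≤ₙ (w ⊔ x) ⊔ (y ⊔ z)
  l = ℕₚ.m≤m⊔n (w ⊔ x) (y ⊔ z)
  r : y ⊔ z ≤ₙ (w ⊔ x) ⊔ (y ⊔ z)
  r = ℕₚ.m≤n⊔m (w ⊔ x) (y ⊔ z)
  along : ∀ {k m n} → k ≡ m ⊔ n → k ≡ m ⊎ k ≡ n
  along {m = m} {n} eq with ℕₚ.⊔-sel m n
  ... | inj₁ s = inj₁ (trans eq s)
  ... | inj₂ s = inj₂ (trans eq s)
  pick : ∀ {k} → k ≡ w ⊔ x ⊎ k ≡ y ⊔ z → (k ≡ w ⊎ k ≡ x) ⊎ (k ≡ y ⊎ k ≡ z)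
  pick (inj₁ eq) = inj₁ (along eq)
  pick (inj₂ eq) = inj₂ (along eq)

module _ (b₁ b₂ a₁ a₂ : ℤ) where
  private
    α₊ α₋ β₊ β₋ : ℕ
    α₊ = abs (⟦ unit a₁ a₂ ⟧ 1ℤ)
    α₋ = abs (⟦ unit a₁ a₂ ⟧ -1ℤ)
    β₊ = abs (⟦ unit b₁ b₂ ⟧ 1ℤ)
    β₋ = abs (⟦ unit b₁ b₂ ⟧ -1ℤ)

  module _ {K} (b≤ : abs b₁ ≤ₙ suc K × abs b₂ ≤ₙ suc K) (a≤ : abs a₁ ≤ₙ suc K × abs a₂ ≤ₙ suc K) (3≤K : 3 ≤ₙ K) where
    open Orbit {suc K} (s≤s z≤n) {b₁} {b₂} {a₁} {a₂} (proj₁ b≤) (proj₂ b≤) (proj₁ a≤) (proj₂ a≤)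

    private
      package : (∀ d → Chain (suc K) b₁ b₂ a₁ a₂ d) → Unlimited b₁ b₂ a₁ a₂
      package ch = record { M = suc K ; 1≤M = s≤s z≤n ; b₁≤ = proj₁ b≤ ; b₂≤ = proj₂ b≤ ; chain = ch }

    unlimited-a : ∀ ε → ε * ε ≡ 1ℤ → K ≡ abs (⟦ unit a₁ a₂ ⟧ ε) → Unlimited b₁ b₂ a₁ a₂
    unlimited-a ε ε² refl = package (from₁ (chain-seed b₁ b₂ a₁ a₂ ε ε² 3≤K (proj₂ b≤)))

    unlimited-b : ∀ ε → ε * ε ≡ 1ℤ → K ≡ abs (⟦ unit b₁ b₂ ⟧ ε) → Unlimited b₁ b₂ a₁ a₂
    unlimited-b ε ε² refl = package (from₂ (chain-seed a₂ a₁ b₁ b₂ ε ε² 3≤K (proj₁ a≤)))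

  unlimited : 1 ≤ₙ β₊ → 1 ≤ₙ β₋ → 1 ≤ₙ α₊ → 1 ≤ₙ α₋ → Unlimited b₁ b₂ a₁ a₂
  unlimited 1≤β₊ 1≤β₋ 1≤α₊ 1≤α₋ with max₄ β₊ β₋ α₊ α₋
  ... | K , ((β₊≤ , β₋≤) , (α₊≤ , α₋≤)) , attained = decide (3 ≤? K) attained
    where
    b≤ : abs b₁ ≤ₙ suc K × abs b₂ ≤ₙ suc K
    b≤ = values-bound b₁ b₂ β₊≤ β₋≤
    a≤ : abs a₁ ≤ₙ suc K × abs a₂ ≤ₙ suc K
    a≤ = values-bound a₁ a₂ α₊≤ α₋≤
    decide : Dec (3 ≤ₙ K) → (K ≡ β₊ ⊎ K ≡ β₋) ⊎ (K ≡ α₊ ⊎ K ≡ α₋) → Unlimited b₁ b₂ a₁ a₂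
    decide (yes 3≤K) (inj₁ (inj₁ eq)) = unlimited-b b≤ a≤ 3≤K 1ℤ refl eq
    decide (yes 3≤K) (inj₁ (inj₂ eq)) = unlimited-b b≤ a≤ 3≤K -1ℤ refl eq
    decide (yes 3≤K) (inj₂ (inj₁ eq)) = unlimited-a b≤ a≤ 3≤K 1ℤ refl eq
    decide (yes 3≤K) (inj₂ (inj₂ eq)) = unlimited-a b≤ a≤ 3≤K -1ℤ refl eq
    decide (no K<3) _ = record
      { M = 3 ; 1≤M = s≤s z≤n
      ; b₁≤ = ℕₚ.≤-trans (proj₁ b≤) (s≤s K≤2) ; b₂≤ = ℕₚ.≤-trans (proj₂ b≤) (s≤s K≤2)
      ; chain = proper⇒chain b₁ b₂ a₁ a₂
          ((1≤β₊ , ℕₚ.≤-trans β₊≤ K≤2) , (1≤β₋ , ℕₚ.≤-trans β₋≤ K≤2))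
          ((1≤α₊ , ℕₚ.≤-trans α₊≤ K≤2) , (1≤α₋ , ℕₚ.≤-trans α₋≤ K≤2)) }
      where
      K≤2 : K ≤ₙ 2
      K≤2 = ℕₚ.≤-pred (ℕₚ.≰⇒> K<3)

unlimited⇒unbounded : ∀ a₁ a₂ b₁ b₂ → Unlimited b₁ b₂ a₁ a₂ → Unbounded (IsSolution 1ℤ 1ℤ a₁ a₂ b₁ b₂ 1ℤ)
unlimited⇒unbounded a₁ a₂ b₁ b₂ unl B = weaken
  (point⇒solution {1ℤ} {M} (λ cop → cop)
    (subst (Bounded M) (sym Q₁≡) (bounded refl b₁≤ b₂≤ 1≤M)) (ℕₚ.m≤m+n _ B)
    (subst₂ (λ Q Q′ → Point Q Q′ 1ℤ (2 · M ⊹ 2 ⊹ B)) (sym Q₁≡) (sym Q₂≡) (chain B)))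
  where
  open Unlimited unl
  open Start 1ℤ 1ℤ a₁ a₂ b₁ b₂ 1ℤ
  Q₁≡ : Q₁ ≡ unit b₁ b₂
  Q₁≡ = reflect-unit b₂ b₁
  Q₂≡ : Q₂ ≡ unit a₁ a₂
  Q₂≡ = reflect-unit a₂ a₁
  weaken : (∃ λ s → IsSolution 1ℤ 1ℤ a₁ a₂ b₁ b₂ 1ℤ s × 2 · M ⊹ 2 ⊹ B ≤ₙ size s) →
    ∃ λ s → IsSolution 1ℤ 1ℤ a₁ a₂ b₁ b₂ 1ℤ s × B ≤ₙ size s
  weaken (s , sol , le) = s , sol , ℕₚ.≤-trans (ℕₚ.m≤n+m B (2 · M ⊹ 2)) le

-- Symmetries of the equation

unbounded-map : ∀ {P P′ : ℤ × ℤ × ℤ → Set} (f : ℤ × ℤ × ℤ → ℤ × ℤ × ℤ) →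
  (∀ s → P s → P′ (f s)) → (∀ s → size (f s) ≡ size s) → Unbounded P → Unbounded P′
unbounded-map f on-P on-size unb B with unb B
... | s , Ps , B≤ = f s , on-P s Ps , subst (B ≤ₙ_) (sym (on-size s)) B≤

unbounded-swap : ∀ a b a₁ a₂ b₁ b₂ c →
  Unbounded (IsSolution b a b₁ b₂ a₁ a₂ c) → Unbounded (IsSolution a b a₁ a₂ b₁ b₂ c)
unbounded-swap a b a₁ a₂ b₁ b₂ c = unbounded-map (λ (x , y , z) → y , x , z)
  (λ (x , y , z) eq → trans (left x y z) (trans eq (right a b a₁ a₂ b₁ b₂ c (x ^ 3) (y ^ 3) (x ^ 2) (y ^ 2) x y)))
  (λ (x , y , z) → cong (_⊹ abs z) (ℕₚ.+-comm (abs y) (abs x)))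
  where
  left : ∀ x y z → y * x * z ≡ x * y * z
  left = solve-∀
  right : ∀ a b a₁ a₂ b₁ b₂ c x₃ y₃ x₂ y₂ x y →
    b * x₃ + a * y₃ + c + b₂ * x₂ + b₁ * x + a₂ * y₂ + a₁ * y
    ≡ a * y₃ + b * x₃ + c + a₂ * y₂ + a₁ * y + b₂ * x₂ + b₁ * x
  right = solve-∀

unbounded-neg-x : ∀ a b a₁ a₂ b₁ b₂ c →
  Unbounded (IsSolution (- a) b (- a₁) a₂ b₁ b₂ c) → Unbounded (IsSolution a b a₁ a₂ b₁ b₂ c)
unbounded-neg-x a b a₁ a₂ b₁ b₂ c = unbounded-map (λ (x , y , z) → - x , y , - z)
  (λ (x , y , z) eq → trans (left x y z) (trans eq (right a b a₁ a₂ b₁ b₂ c x (y ^ 3) (y ^ 2) y)))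
  (λ (x , y , z) → cong₂ (λ m n → m ⊹ abs y ⊹ n) (∣-i∣≡∣i∣ x) (∣-i∣≡∣i∣ z))
  where
  left : ∀ x y z → - x * y * - z ≡ x * y * z
  left = solve-∀
  right : ∀ a b a₁ a₂ b₁ b₂ c x y₃ y₂ y →
    - a * (x * (x * (x * 1ℤ))) + b * y₃ + c + a₂ * (x * (x * 1ℤ)) + - a₁ * x + b₂ * y₂ + b₁ * y
    ≡ a * (- x * (- x * (- x * 1ℤ))) + b * y₃ + c + a₂ * (- x * (- x * 1ℤ)) + a₁ * - x + b₂ * y₂ + b₁ * y
  right = solve-∀

unbounded-neg : ∀ a b a₁ a₂ b₁ b₂ c →
  Unbounded (IsSolution (- a) (- b) (- a₁) (- a₂) (- b₁) (- b₂) (- c)) → Unbounded (IsSolution a b a₁ a₂ b₁ b₂ c)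
unbounded-neg a b a₁ a₂ b₁ b₂ c = unbounded-map (λ (x , y , z) → x , y , - z)
  (λ (x , y , z) eq → trans (left x y z) (trans (cong -_ eq) (right a b a₁ a₂ b₁ b₂ c (x ^ 3) (y ^ 3) (x ^ 2) (y ^ 2) x y)))
  (λ (x , y , z) → cong (abs x ⊹ abs y ⊹_) (∣-i∣≡∣i∣ z))
  where
  left : ∀ x y z → x * y * - z ≡ - (x * y * z)
  left = solve-∀
  right : ∀ a b a₁ a₂ b₁ b₂ c x₃ y₃ x₂ y₂ x y →
    - (- a * x₃ + - b * y₃ + - c + - a₂ * x₂ + - a₁ * x + - b₂ * y₂ + - b₁ * y)
    ≡ a * x₃ + b * y₃ + c + a₂ * x₂ + a₁ * x + b₂ * y₂ + b₁ * y
  right = solve-∀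

-- Parabolas on the surface when a value at ±1 vanishes

line-+ : ∀ a₁ a₂ b₁ b₂ → ⟦ unit a₁ a₂ ⟧ 1ℤ ≡ 0ℤ → Unbounded (IsSolution 1ℤ 1ℤ a₁ a₂ b₁ b₂ 1ℤ)
line-+ a₁ a₂ b₁ b₂ V≡0 B = (1ℤ , y , z) ,
  trans (sym (addZero (1ℤ * y * z))) (trans (cong (λ m → 1ℤ * y * z + m) (sym V≡0)) (identity a₁ a₂ b₁ b₂ y)) ,
  ℕₚ.≤-trans (ℕₚ.m≤n+m B 1) (ℕₚ.m≤m+n _ (abs z))
  where
  y z : ℤ
  y = + B
  -- In the plane x = 1 the equation reduces to y z = y ³ + b₂ y ² + b₁ y, which holds along this
  -- parabola.
  z = y * y + b₂ * y + b₁
  addZero : ∀ m → m + 0ℤ ≡ m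
  addZero = solve-∀
  identity : ∀ a₁ a₂ b₁ b₂ y → 1ℤ * y * (y * y + b₂ * y + b₁) + (1ℤ * 1ℤ + a₁ * 1ℤ + a₂ * 1ℤ + 1ℤ)
    ≡ 1ℤ * 1ℤ + 1ℤ * (y * (y * (y * 1ℤ))) + 1ℤ + a₂ * 1ℤ + a₁ * 1ℤ + b₂ * (y * (y * 1ℤ)) + b₁ * y
  identity = solve-∀

line-- : ∀ a₁ a₂ b₁ b₂ → ⟦ unit a₁ a₂ ⟧ -1ℤ ≡ 0ℤ → Unbounded (IsSolution 1ℤ 1ℤ a₁ a₂ b₁ b₂ 1ℤ)
line-- a₁ a₂ b₁ b₂ V≡0 B = (-1ℤ , y , z) ,
  -- Reversing the coefficients changes the sign of the value at -1, hence `- m`.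
  trans (sym (addZero (-1ℤ * y * z))) (trans (cong (λ m → -1ℤ * y * z + - m) (sym V≡0)) (identity a₁ a₂ b₁ b₂ y)) ,
  ℕₚ.≤-trans (ℕₚ.m≤n+m B 1) (ℕₚ.m≤m+n _ (abs z))
  where
  y z : ℤ
  y = + B
  z = - (y * y + b₂ * y + b₁)
  addZero : ∀ m → m + 0ℤ ≡ m
  addZero = solve-∀
  identity : ∀ a₁ a₂ b₁ b₂ y → -1ℤ * y * - (y * y + b₂ * y + b₁) + - (1ℤ * -1ℤ + a₁ * 1ℤ + a₂ * -1ℤ + 1ℤ)
    ≡ 1ℤ * -1ℤ + 1ℤ * (y * (y * (y * 1ℤ))) + 1ℤ + a₂ * 1ℤ + a₁ * -1ℤ + b₂ * (y * (y * 1ℤ)) + b₁ * y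
  identity = solve-∀

0⊎1≤ : ∀ i → i ≡ 0ℤ ⊎ 1 ≤ₙ abs i
0⊎1≤ (+ zero) = inj₁ refl
0⊎1≤ (+ suc n) = inj₂ (s≤s z≤n)
0⊎1≤ -[1+ n ] = inj₂ (s≤s z≤n)

unbounded-monic : ∀ a₁ a₂ b₁ b₂ → Unbounded (IsSolution 1ℤ 1ℤ a₁ a₂ b₁ b₂ 1ℤ)
unbounded-monic a₁ a₂ b₁ b₂ =
  decide (0⊎1≤ (⟦ unit b₁ b₂ ⟧ 1ℤ)) (0⊎1≤ (⟦ unit b₁ b₂ ⟧ -1ℤ)) (0⊎1≤ (⟦ unit a₁ a₂ ⟧ 1ℤ)) (0⊎1≤ (⟦ unit a₁ a₂ ⟧ -1ℤ))
  where
  Value : ℤ → Set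
  Value i = i ≡ 0ℤ ⊎ 1 ≤ₙ abs i
  swap : Unbounded (IsSolution 1ℤ 1ℤ b₁ b₂ a₁ a₂ 1ℤ) → Unbounded (IsSolution 1ℤ 1ℤ a₁ a₂ b₁ b₂ 1ℤ)
  swap = unbounded-swap 1ℤ 1ℤ a₁ a₂ b₁ b₂ 1ℤ
  decide : Value (⟦ unit b₁ b₂ ⟧ 1ℤ) → Value (⟦ unit b₁ b₂ ⟧ -1ℤ) →
    Value (⟦ unit a₁ a₂ ⟧ 1ℤ) → Value (⟦ unit a₁ a₂ ⟧ -1ℤ) → Unbounded (IsSolution 1ℤ 1ℤ a₁ a₂ b₁ b₂ 1ℤ)
  decide (inj₁ β₊≡0) _ _ _ = swap (line-+ b₁ b₂ a₁ a₂ β₊≡0)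
  decide _ (inj₁ β₋≡0) _ _ = swap (line-- b₁ b₂ a₁ a₂ β₋≡0)
  decide _ _ (inj₁ α₊≡0) _ = line-+ a₁ a₂ b₁ b₂ α₊≡0
  decide _ _ _ (inj₁ α₋≡0) = line-- a₁ a₂ b₁ b₂ α₋≡0
  decide (inj₂ β₊) (inj₂ β₋) (inj₂ α₊) (inj₂ α₋) =
    unlimited⇒unbounded a₁ a₂ b₁ b₂ (unlimited b₁ b₂ a₁ a₂ β₊ β₋ α₊ α₋)

abs≡1 : ∀ i → abs i ≡ 1 → i ≡ 1ℤ ⊎ - i ≡ 1ℤ
abs≡1 (+ 1) refl = inj₁ refl
abs≡1 -[1+ 0 ] refl = inj₂ refl

unbounded-unit : ∀ a b a₁ a₂ b₁ b₂ c → abs a ≡ 1 → abs b ≡ 1 → abs c ≡ 1 →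
  Unbounded (IsSolution a b a₁ a₂ b₁ b₂ c)
unbounded-unit a b a₁ a₂ b₁ b₂ c ∣a∣ ∣b∣ ∣c∣ = fix-c (abs≡1 c ∣c∣)
  where
  fix-a : ∀ a a₁ a₂ b₁ b₂ → a ≡ 1ℤ ⊎ - a ≡ 1ℤ → Unbounded (IsSolution a 1ℤ a₁ a₂ b₁ b₂ 1ℤ)
  fix-a a a₁ a₂ b₁ b₂ (inj₁ refl) = unbounded-monic a₁ a₂ b₁ b₂
  fix-a a a₁ a₂ b₁ b₂ (inj₂ -a≡1) = unbounded-neg-x a 1ℤ a₁ a₂ b₁ b₂ 1ℤ
    (subst (λ m → Unbounded (IsSolution m 1ℤ (- a₁) a₂ b₁ b₂ 1ℤ)) (sym -a≡1) (unbounded-monic (- a₁) a₂ b₁ b₂))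
  fix-b : ∀ a b a₁ a₂ b₁ b₂ → abs a ≡ 1 → b ≡ 1ℤ ⊎ - b ≡ 1ℤ → Unbounded (IsSolution a b a₁ a₂ b₁ b₂ 1ℤ)
  fix-b a b a₁ a₂ b₁ b₂ ∣a∣ (inj₁ refl) = fix-a a a₁ a₂ b₁ b₂ (abs≡1 a ∣a∣)
  -- The sign of `b` is changed by conjugating the sign change in x with the exchange of x and y.
  fix-b a b a₁ a₂ b₁ b₂ ∣a∣ (inj₂ -b≡1) = unbounded-swap a b a₁ a₂ b₁ b₂ 1ℤ
    (unbounded-neg-x b a b₁ b₂ a₁ a₂ 1ℤ
      (unbounded-swap (- b) a (- b₁) b₂ a₁ a₂ 1ℤ
        (subst (λ m → Unbounded (IsSolution a m a₁ a₂ (- b₁) b₂ 1ℤ)) (sym -b≡1)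
          (fix-a a a₁ a₂ (- b₁) b₂ (abs≡1 a ∣a∣)))))
  fix-c : c ≡ 1ℤ ⊎ - c ≡ 1ℤ → Unbounded (IsSolution a b a₁ a₂ b₁ b₂ c)
  fix-c (inj₁ refl) = fix-b a b a₁ a₂ b₁ b₂ ∣a∣ (abs≡1 b ∣b∣)
  fix-c (inj₂ -c≡1) = unbounded-neg a b a₁ a₂ b₁ b₂ c
    (subst (λ m → Unbounded (IsSolution (- a) (- b) (- a₁) (- a₂) (- b₁) (- b₂) m)) (sym -c≡1)
      (fix-b (- a) (- b) (- a₁) (- a₂) (- b₁) (- b₂) (trans (∣-i∣≡∣i∣ a) ∣a∣)
        (abs≡1 (- b) (trans (∣-i∣≡∣i∣ b) ∣b∣))))

-- The case c = 0 and the distinction of cases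

unbounded-c≡0 : ∀ a b a₁ a₂ b₁ b₂ → Unbounded (IsSolution a b a₁ a₂ b₁ b₂ 0ℤ)
unbounded-c≡0 a b a₁ a₂ b₁ b₂ B = (0ℤ , 0ℤ , + B) , identity a b a₁ a₂ b₁ b₂ , ℕₚ.≤-refl
  where
  identity : ∀ a b a₁ a₂ b₁ b₂ → 0ℤ ≡ a * 0ℤ + b * 0ℤ + 0ℤ + a₂ * 0ℤ + a₁ * 0ℤ + b₂ * 0ℤ + b₁ * 0ℤ
  identity = solve-∀

unbounded : ∀ a b a₁ a₂ b₁ b₂ c → a ≢ 0ℤ → b ≢ 0ℤ → Unbounded (IsSolution a b a₁ a₂ b₁ b₂ c)
unbounded a b a₁ a₂ b₁ b₂ c a≢0 b≢0 = decide (0⊎1≤ a) (0⊎1≤ b) (0⊎1≤ c)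
  where
  split : 1 ≤ₙ abs a → 1 ≤ₙ abs b → 1 ≤ₙ abs c → Dec (2 ≤ₙ abs a · (abs b · abs c)) →
    Unbounded (IsSolution a b a₁ a₂ b₁ b₂ c)
  split 1≤a 1≤b 1≤c (yes 2≤abc) = unbounded-nonunit a b a₁ a₂ b₁ b₂ c 1≤a 1≤b 1≤c 2≤abc
  split 1≤a 1≤b 1≤c (no abc<2) = unbounded-unit a b a₁ a₂ b₁ b₂ c
    (ℕₚ.m*n≡1⇒m≡1 (abs a) _ abc≡1) (ℕₚ.m*n≡1⇒m≡1 (abs b) _ bc≡1) (ℕₚ.m*n≡1⇒n≡1 (abs b) _ bc≡1)
    where
    abc≡1 : abs a · (abs b · abs c) ≡ 1
    abc≡1 = ℕₚ.≤-antisym (ℕₚ.≤-pred (ℕₚ.≰⇒> abc<2)) (ℕₚ.*-mono-≤ 1≤a (ℕₚ.*-mono-≤ 1≤b 1≤c))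
    bc≡1 : abs b · abs c ≡ 1
    bc≡1 = ℕₚ.m*n≡1⇒n≡1 (abs a) _ abc≡1
  decide : a ≡ 0ℤ ⊎ 1 ≤ₙ abs a → b ≡ 0ℤ ⊎ 1 ≤ₙ abs b → c ≡ 0ℤ ⊎ 1 ≤ₙ abs c →
    Unbounded (IsSolution a b a₁ a₂ b₁ b₂ c)
  decide (inj₁ a≡0) _ _ = ⊥-elim (a≢0 a≡0)
  decide _ (inj₁ b≡0) _ = ⊥-elim (b≢0 b≡0)
  decide _ _ (inj₁ refl) = unbounded-c≡0 a b a₁ a₂ b₁ b₂
  decide (inj₂ 1≤a) (inj₂ 1≤b) (inj₂ 1≤c) = split 1≤a 1≤b 1≤c (2 ≤? abs a · (abs b · abs c))

-- From unbounded sizes to infinitely many solutions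

size≤sum : ∀ {s} L → s ∈ L → size s ≤ₙ sum (map size L)
size≤sum (s ∷ L) (here refl) = ℕₚ.m≤m+n (size s) _
size≤sum (t ∷ L) (there s∈L) = ℕₚ.≤-trans (size≤sum L s∈L) (ℕₚ.m≤n+m _ (size t))

unbounded⇒infinite : ∀ {P} → Unbounded P → InfinitelyMany P
unbounded⇒infinite unb L with unb (suc (sum (map size L)))
... | s , Ps , large = s , Ps , λ s∈L → ℕₚ.<⇒≱ large (size≤sum L s∈L)

theorem3 : (a b a₁ a₂ b₁ b₂ c : ℤ) → a ≢ 0ℤ → b ≢ 0ℤ →
    InfinitelyMany (IsSolution a b a₁ a₂ b₁ b₂ c)
theorem3 a b a₁ a₂ b₁ b₂ c a≢0 b≢0 = unbounded⇒infinite (unbounded a b a₁ a₂ b₁ b₂ c a≢0 b≢0)
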